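{- Let $\Gamma$ be the integer lattice graph, let $\Sigma$ be a perfect dominating set of $\Gamma$, let $\Lambda=\Gamma\setminus\Sigma$ be the complementary graph of $\Sigma$ in $\Gamma$, and let $M(\Lambda)$ be the planar map of $\Lambda$ induced by the standard embedding of $\Gamma$ in $\mathbb{R}^2$. Assume that all belts of $M(\Lambda)$ have lengths divisible by 4; in other words, assume that the components of the subgraph $\Gamma\setminus\Lambda$ of $\Gamma$ induced by $\Sigma$ all have vertex sets of odd cardinality. Then $\Lambda$ has DETGCs and RETGCs that yield corresponding PFCs of $M(\Lambda)$.
   Context: The integer lattice graph $\Gamma$ has vertex set $\mathbb{Z}^2$, two vertices being adjacent iff their Euclidean distance is 1. A perfect dominating set (PDS) of a graph $\Gamma$ is a vertex subset $\Sigma$ such that each vertex not in $\Sigma$ is adjacent to exactly one element of $\Sigma$; $\Gamma\setminus\Sigma$ is the graph obtained by deleting the vertices of $\Sigma$ (here it is cubic). Write $[3]_0=\{0,1,2,3\}$. For a cubic graph $G$: a set $S_0\subseteq V(G)$ is an efficient dominating set (EDS) if $|N_G[v]\cap S_0|=1$ for every $v\in V(G)$. A total coloring colors vertices and edges so that no two incident or adjacent elements get the same color. An efficient total coloring (ETC) of $G$ is a total coloring $\mu:V(G)\cup E(G)\to[3]_0$ such that for each vertex $v$ the restriction of $\mu$ to $N_G[v]$ is a bijection onto $[3]_0$, and the four vertex color classes partition $V(G)$ into EDSs. An ETGC is an ETC in which every 4-cycle of $G$ has each of the four colors exactly once on its vertices and exactly once on its edges. In a map (embedding with faces being disks), a belt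 is a face boundary cycle. Given an ETGC of a map, a belt is directed (resp. reversed) if each color-0 edge $e$ on it lies in the clockwise (resp. counterclockwise) direction from a color-0 vertex $v$ of the belt, with distance 1 from $v$ to the nearest end-vertex of $e$. An ETGC is a DETGC (resp. RETGC) if every belt is directed (resp. reversed). An ETGC is periodic if for each belt, traversed in one of its two directions, the alternating cyclic sequence of colors (vertex, edge, vertex, edge, ...) is a concatenation of copies of $a,b,c,a,d,c,b,d$ for some $\{a,b,c,d\}=[3]_0$ (odd positions vertex colors, even positions edge colors). The PFC corresponding to a periodic ETGC $\mu'$ is the face coloring $\mu$ assigning to the face with belt $B$ the permutation $\mu(B)=abc$ of $\{1,2,3\}$, where $0,a,b,c$ are the $\mu'$-colors of four consecutive vertices of $B$ in clockwise order starting at a vertex of color $0$; adjacent faces receive distinct permutations. -}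

module Defs where

open import Data.Fin.Base using (Fin; suc; toℕ)
open import Data.Fin.Patterns using (0F; 1F; 2F; 3F)
open import Data.Fin.Permutation using (Permutation′; _⟨$⟩ʳ_; _≈_)
open import Data.Integer.Base using (ℤ; 0ℤ; 1ℤ; _+_; _-_; _*_) renaming (suc to sucℤ)
open import Data.Integer.Properties using (+-inverseʳ)
open import Data.Integer.Tactic.RingSolver using (solve-∀)
open import Data.Nat.Base as ℕ using (ℕ)
open import Data.Nat.Divisibility using (_∣_)
open import Data.Product using (∃; ∃!; ∃-syntax; _×_; _,_)
open import Data.Refinement using (Refinement-syntax; value)
open import Data.Sum.Base using (_⊎_)
open import Function.Definitions using (Bijective)
open import Level using (0ℓ)
open import Relation.Binary.Construct.Closure.Equivalence using (EqClosure)
open import Relation.Binary.Core using (Rel)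
open import Relation.Binary.Definitions using (Symmetric)
open import Relation.Binary.PropositionalEquality
  using (_≡_; _≢_; refl; sym; trans; cong; cong₂)
open import Relation.Nullary.Negation using (¬_)
open import Relation.Unary using (Pred; _∈_; _∉_)

record Graph : Set₁ where
  field
    V      : Set
    _~_    : Rel V 0ℓ
    ~-sym  : Symmetric _~_
    ~-irr  : ∀ {v} → ¬ (v ~ v)

module _ (G : Graph) where
  open Graph G

  ClosedNbr : V → Pred V 0ℓ
  ClosedNbr v u = u ≡ v ⊎ v ~ u

  IsPerfectDominating : Pred V 0ℓ → Set
  IsPerfectDominating S = ∀ v → v ∉ S → ∃! _≡_ λ u → u ∈ S × v ~ u

  IsEfficientDominating : Pred V 0ℓ → Set
  IsEfficientDominating S = ∀ v → ∃! _≡_ λ u → ClosedNbr v u × u ∈ S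

  -- A cycle of length `len`, as the `len`-periodic sequence of its
  -- vertices; vertex and edge positions are thus read modulo `len`.
  record Cycle : Set where
    field
      len      : ℕ
      3≤len    : 3 ℕ.≤ len
      at       : ℕ → V
      periodic : ∀ i → at (len ℕ.+ i) ≡ at i
      distinct : ∀ {i j} → i ℕ.< len → j ℕ.< len → at i ≡ at j → i ≡ j
      step     : ∀ i → at i ~ at (ℕ.suc i)

induced : (G : Graph) → Pred (Graph.V G) 0ℓ → Graph
induced G P = record
  { V     = [ v ∈ V ∣ v ∈ P ]
  ; _~_   = λ u v → value u ~ value v
  ; ~-sym = ~-sym
  ; ~-irr = ~-irr
  } where open Graph G

infix 5 _∖_
_∖_ : (G : Graph) → Pred (Graph.V G) 0ℓ → Graph
G ∖ S = induced G (_∉ S)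

Colour : Set
Colour = Fin 4

record Colouring (G : Graph) : Set where
  open Graph G
  field
    vertex   : V → Colour
    edge     : ∀ u v → .(u ~ v) → Colour
    edge-sym : ∀ u v (e : u ~ v) → edge u v e ≡ edge v u (~-sym e)

module _ {G : Graph} (μ : Colouring G) where
  open Graph G
  open Colouring μ

  record IsTotal : Set where
    field
      vertex≢vertex : ∀ u v → u ~ v → vertex u ≢ vertex v
      vertex≢edge   : ∀ u v (e : u ~ v) → vertex u ≢ edge u v e
      edge≢edge     : ∀ u v w (e : u ~ v) (f : u ~ w) → v ≢ w →
                      edge u v e ≢ edge u w f

  record IsETC : Set where
    field
      total     : IsTotal
      efficient : ∀ v → Bijective _≡_ _≡_
                    (λ (u : [ u ∈ V ∣ u ∈ ClosedNbr G v ]) → vertex (value u))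
      classes   : ∀ c → IsEfficientDominating G (λ v → vertex v ≡ c)

  module _ (C : Cycle G) where
    open Cycle C

    vertexAt : ℕ → Colour
    vertexAt i = vertex (at i)

    -- The colour of the edge between positions i and i + 1.
    edgeAt : ℕ → Colour
    edgeAt i = edge (at i) (at (ℕ.suc i)) (step i)

  record IsETGC : Set where
    field
      etc     : IsETC
      4-cycle : ∀ (C : Cycle G) → Cycle.len C ≡ 4 →
                Bijective _≡_ _≡_ (λ (i : Fin 4) → vertexAt C (toℕ i)) ×
                Bijective _≡_ _≡_ (λ (i : Fin 4) → edgeAt C (toℕ i))

ℤ² : Set
ℤ² = ℤ × ℤ

dist² : ℤ² → ℤ² → ℤ
dist² (x , y) (x′ , y′) = (x - x′) * (x - x′) + (y - y′) * (y - y′)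

dist²-comm : ∀ p q → dist² p q ≡ dist² q p
dist²-comm (x , y) (x′ , y′) = cong₂ _+_ (flip-square x x′) (flip-square y y′)
  where
  flip-square : ∀ a b → (a - b) * (a - b) ≡ (b - a) * (b - a)
  flip-square = solve-∀

dist²-self : ∀ p → dist² p p ≡ 0ℤ
dist²-self (x , y) = cong₂ (λ a b → a * a + b * b) (+-inverseʳ x) (+-inverseʳ y)

Γ : Graph
Γ = record
  { V     = ℤ²
  ; _~_   = λ p q → dist² p q ≡ 1ℤ
  ; ~-sym = λ {p} {q} e → trans (dist²-comm q p) e
  ; ~-irr = λ {p} e → 0≢1 (trans (sym (dist²-self p)) e)
  }
  where
  0≢1 : 0ℤ ≢ 1ℤ
  0≢1 ()

-- The pair (x , y) also names the unit square [x, x+1] × [y, y+1].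
Square : Set
Square = ℤ²

-- `Side s u v`: the edge from u to v is a side of the square s, traversed
-- clockwise around s; that is, s lies immediately to its right.
data Side : Square → ℤ² → ℤ² → Set where
  west  : ∀ {x y} → Side (x , y) (x , y) (x , sucℤ y)
  north : ∀ {x y} → Side (x , y) (x , sucℤ y) (sucℤ x , sucℤ y)
  east  : ∀ {x y} → Side (x , y) (sucℤ x , sucℤ y) (sucℤ x , y)
  south : ∀ {x y} → Side (x , y) (sucℤ x , y) (x , y)

module PlanarMap (S : Pred ℤ² 0ℓ) where

  Λ : Graph
  Λ = Γ ∖ S

  open Graph Λ using (V)

  -- The squares s and t share a side that is not an edge of Λ.
  Merged : Rel Square 0ℓ
  Merged s t = ∃[ u ] ∃[ v ] Side s u v × Side t v u × ¬ (u ∉ S × v ∉ S)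

  -- The faces (the connected components of ℝ² minus the embedded Λ) are
  -- the classes of unit squares glued along sides that are not edges of Λ.
  -- A face is named by any one of its squares.
  SameFace : Rel Square 0ℓ
  SameFace = EqClosure Merged

  -- C, in its given direction, is the whole boundary of the face of s
  -- traversed with that face on the right, i.e. clockwise.
  record IsBelt (s : Square) (C : Cycle Λ) : Set where
    open Cycle C
    field
      bounds : ∀ i → ∃[ t ] SameFace s t ×
                 Side t (value (at i)) (value (at (ℕ.suc i)))
      whole  : ∀ t (u v : V) → SameFace s t → Side t (value u) (value v) →
                 ∃[ i ] at i ≡ u × at (ℕ.suc i) ≡ v

  -- The faces are disks, each with a (finite) boundary cycle.
  IsMap : Set
  IsMap = ∀ s → ∃ (IsBelt s)

  BeltLengthsDivisibleBy : ℕ → Set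
  BeltLengthsDivisibleBy k = ∀ s C → IsBelt s C → k ∣ Cycle.len C

  module _ (μ : Colouring Λ) where
    open Colouring μ

    -- Every edge of a belt is the one between positions i + 1 and i + 2 for
    -- some i; position i is then the place on the belt at distance 1 from it
    -- from which it lies in the clockwise direction.
    Directed : Cycle Λ → Set
    Directed C = ∀ i → edgeAt μ C (1 ℕ.+ i) ≡ 0F → vertexAt μ C i ≡ 0F

    Reversed : Cycle Λ → Set
    Reversed C = ∀ i → edgeAt μ C i ≡ 0F → vertexAt μ C (2 ℕ.+ i) ≡ 0F

    record IsDETGC : Set where
      field
        etgc     : IsETGC μ
        directed : ∀ s C → IsBelt s C → Directed C

    record IsRETGC : Set where
      field
        etgc     : IsETGC μ
        reversed : ∀ s C → IsBelt s C → Reversed C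

    -- The word a,b,c,a,d,c,b,d is read clockwise from position k up to the
    -- edge before position k + 4.
    record Clockwise (C : Cycle Λ) (a b c d : Colour) (k : ℕ) : Set where
      field
        v₁ : vertexAt μ C k         ≡ a
        e₁ : edgeAt   μ C k         ≡ b
        v₂ : vertexAt μ C (1 ℕ.+ k) ≡ c
        e₂ : edgeAt   μ C (1 ℕ.+ k) ≡ a
        v₃ : vertexAt μ C (2 ℕ.+ k) ≡ d
        e₃ : edgeAt   μ C (2 ℕ.+ k) ≡ c
        v₄ : vertexAt μ C (3 ℕ.+ k) ≡ b
        e₄ : edgeAt   μ C (3 ℕ.+ k) ≡ d

    -- The word a,b,c,a,d,c,b,d is read counterclockwise from position k + 4
    -- down to the edge after position k.
    record Counterclockwise (C : Cycle Λ) (a b c d : Colour) (k : ℕ) : Set where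
      field
        v₁ : vertexAt μ C (4 ℕ.+ k) ≡ a
        e₁ : edgeAt   μ C (3 ℕ.+ k) ≡ b
        v₂ : vertexAt μ C (3 ℕ.+ k) ≡ c
        e₂ : edgeAt   μ C (2 ℕ.+ k) ≡ a
        v₃ : vertexAt μ C (2 ℕ.+ k) ≡ d
        e₃ : edgeAt   μ C (1 ℕ.+ k) ≡ c
        v₄ : vertexAt μ C (1 ℕ.+ k) ≡ b
        e₄ : edgeAt   μ C k         ≡ d

    -- The four letters are given by a permutation π of the colours; k is
    -- where the first copy of the word starts (or, counterclockwise, ends).
    PeriodicBelt : Cycle Λ → Set
    PeriodicBelt C = 4 ∣ Cycle.len C × ∃[ π ] ∃[ k ]
      (Copies Clockwise π k ⊎ Copies Counterclockwise π k)
      where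
      Copies : (Cycle Λ → (a b c d : Colour) → ℕ → Set) →
               Permutation′ 4 → ℕ → Set
      Copies R π k = ∀ m →
        R C (π ⟨$⟩ʳ 0F) (π ⟨$⟩ʳ 1F) (π ⟨$⟩ʳ 2F) (π ⟨$⟩ʳ 3F) (4 ℕ.* m ℕ.+ k)

    IsPeriodic : Set
    IsPeriodic = ∀ s C → IsBelt s C → PeriodicBelt C

    -- A permutation of {1,2,3} is an element of Permutation′ 3, with i : Fin 3
    -- standing for i + 1; abc is the one-line notation, so a, b, c are the
    -- successive values.  A face colouring is a colouring of the squares
    -- that is constant on faces.
    record IsPFC (φ : Square → Permutation′ 3) : Set where
      field
        constant : ∀ s t → SameFace s t → φ s ≈ φ t
        reads    : ∀ s C → IsBelt s C → ∀ i → vertexAt μ C i ≡ 0F →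
                   ∀ (j : Fin 3) →
                   vertexAt μ C (ℕ.suc (toℕ j) ℕ.+ i) ≡ suc (φ s ⟨$⟩ʳ j)
        proper   : ∀ s t (u v : V) →
                   Side s (value u) (value v) → Side t (value v) (value u) →
                   ¬ SameFace s t → ¬ (φ s ≈ φ t)

    YieldsPFC : Set
    YieldsPFC = IsPeriodic × ∃ IsPFC

{-# OPTIONS --safe #-}
module Submission where

-- Why the theorem is true.  Suppose that the vertex colours read along every
-- belt repeat with period 4, with four different colours in a period.  The
-- colours of a face are then given by one bijection from the residues modulo
-- 4 (positions on its belt) to the colours; this makes sense because belt
-- lengths are divisible by 4.  If an edge u-v separates two faces, the
-- colours on one of them determine those on the other.  Say that one belt runs
-- from u to v and reads a,b,c,d from u on.  The neighbours of v are u, the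
-- vertex of colour c after v on this belt, and the vertex before v on the
-- other belt; as v and its neighbours have four different colours, the last
-- one has colour d.  So the other belt, which runs from v to u, reads b,a,c,d
-- from v on (`Compatible`).
--
-- So the admissible colourings of the faces form a bundle over the plane with
-- a connection, and what is needed is a global flat section.  It is built on
-- the unit squares instead of the faces: every square carries the belt of its
-- face, two squares glued along a missing edge carry the same belt up to a
-- rotation, and two squares on either side of an edge of the graph are
-- related as above.  Around a lattice point p the connection is trivial.  If
-- p has been deleted, all four squares lie in one face.  Otherwise exactly
-- one edge at p is missing, the three faces at p share the position of p, and
-- crossing each of the three edges permutes the three other positions by the
-- same 3-cycle, whose cube is the identity.  In both cases this is expressed
-- by a `Frame` at p: a common parametrisation of the four belts in which
-- compatibility is equality.  Since the plane of squares is simply connected,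
-- a compatible family K exists (`Integrate`, `coherent`).
--
-- A vertex takes the colour that K gives it on any face around it.  An edge
-- takes the colour that stands 3 places (for the directed colouring) or 2
-- places (for the reversed one) further along the belt than its first end;
-- both faces of the edge give the same result, because the transposition
-- a,b,c,d to b,a,c,d fixes c and d.  In the frame of p the colours of p, its
-- neighbours and its edges are read off a finite table (`Around`), and that
-- gives the efficient total colouring.  The 4-cycle condition holds for
-- every efficient total colouring (`etc⇒etgc`).  The remaining claims concern
-- one belt at a time, except that adjacent faces get distinct permutations:
-- otherwise the colour following that of u would be the same on both belts,
-- whereas it is b on one and c on the other.

open import Defs
open import Data.Irrelevant using ([_])
open import Data.Fin.Base using (Fin; suc; toℕ; fromℕ<; punchOut)
open import Data.Fin.Patterns using (0F; 1F; 2F; 3F)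
open import Data.Fin.Permutation as Perm using (Permutation′; permutation; _⟨$⟩ʳ_; _⟨$⟩ˡ_; _∘ₚ_; inverseˡ; inverseʳ)
open import Data.Fin.Properties as Fin using (any?; all?; toℕ-fromℕ<)
open import Data.Integer.Base as ℤ using (ℤ; +_; -[1+_]; 0ℤ; 1ℤ; -1ℤ)
import Data.Integer.Properties as ℤ
open import Data.Integer.Tactic.RingSolver using (solve-∀)
import Algebra.Properties.Group as GroupProperties
open import Algebra.Bundles using (AbelianGroup)
open import Data.Nat.Base as ℕ using (ℕ; NonZero)
open import Data.Nat.Divisibility using (_∣_; divides)
open import Data.Nat.DivMod using (_%_; m≡m%n+[m/n]*n; m%n<n; _/_)
import Data.Nat.Properties as ℕ
open import Data.Product using (_,_; proj₁; proj₂)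
open import Data.Product.Base using (_×_; ∃-syntax)
open import Data.Product.Properties using (≡-dec)
open import Data.Refinement using (Refinement; value; _,_)
open import Data.Sum.Base using (_⊎_; inj₁; inj₂)
open import Function.Base using (_∘_)
open import Function.Definitions using (Bijective; Injective)
open import Level using (0ℓ)
open import Relation.Binary.Construct.Closure.Equivalence as Eq using ()
open import Relation.Binary.Construct.Closure.ReflexiveTransitive using (ε; _◅_; _◅◅_)
open import Relation.Binary.Construct.Closure.Symmetric using (SymClosure; fwd; bwd)
open import Relation.Binary.Core using (Rel)
open import Relation.Binary.PropositionalEquality
open import Relation.Nullary.Decidable using (Dec; yes; no; from-yes; map′; recompute; ¬?; _→-dec_; _×-dec_; _⊎-dec_)
open import Relation.Nullary.Negation using (¬_; contradiction)
open import Relation.Nullary.Recomputable using (¬-recompute)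
open import Relation.Unary using (Pred; _∉_)

private module ℤ-Group = GroupProperties (AbelianGroup.group ℤ.+-0-abelianGroup)

-- Residues modulo 4

-- The successor modulo 4.
cyc : Fin 4 → Fin 4
cyc 0F = 1F
cyc 1F = 2F
cyc 2F = 3F
cyc 3F = 0F

cyc⁴ : ∀ a → cyc (cyc (cyc (cyc a))) ≡ a
cyc⁴ 0F = refl
cyc⁴ 1F = refl
cyc⁴ 2F = refl
cyc⁴ 3F = refl

-- Addition modulo 4, defined so that `a ⊕ n` unfolds to n successors of a.
infixl 6 _⊕_
_⊕_ : Fin 4 → Fin 4 → Fin 4
a ⊕ 0F = a
a ⊕ 1F = cyc a
a ⊕ 2F = cyc (cyc a)
a ⊕ 3F = cyc (cyc (cyc a))

neg : Fin 4 → Fin 4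
neg 0F = 0F
neg 1F = 3F
neg 2F = 2F
neg 3F = 1F

⊕-cyc : ∀ a b → a ⊕ cyc b ≡ cyc (a ⊕ b)
⊕-cyc a 0F = refl
⊕-cyc a 1F = refl
⊕-cyc a 2F = refl
⊕-cyc a 3F = sym (cyc⁴ a)

⊕-identityˡ : ∀ a → 0F ⊕ a ≡ a
⊕-identityˡ = from-yes (all? λ a → 0F ⊕ a Fin.≟ a)

⊕-assoc : ∀ a b c → (a ⊕ b) ⊕ c ≡ a ⊕ (b ⊕ c)
⊕-assoc = from-yes (all? λ a → all? λ b → all? λ c → (a ⊕ b) ⊕ c Fin.≟ a ⊕ (b ⊕ c))

⊕-comm : ∀ a b → a ⊕ b ≡ b ⊕ a
⊕-comm = from-yes (all? λ a → all? λ b → a ⊕ b Fin.≟ b ⊕ a)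

⊕-inverseʳ : ∀ a → a ⊕ neg a ≡ 0F
⊕-inverseʳ = from-yes (all? λ a → a ⊕ neg a Fin.≟ 0F)

⊕-neg-cancel : ∀ a b → a ⊕ (neg a ⊕ b) ≡ b
⊕-neg-cancel a b = begin
  a ⊕ (neg a ⊕ b)  ≡⟨ ⊕-assoc a (neg a) b ⟨
  (a ⊕ neg a) ⊕ b  ≡⟨ cong (_⊕ b) (⊕-inverseʳ a) ⟩
  0F ⊕ b           ≡⟨ ⊕-identityˡ b ⟩
  b                ∎
  where open ≡-Reasoning

neg-⊕-cancel : ∀ a b → neg a ⊕ (a ⊕ b) ≡ b
neg-⊕-cancel a b = begin
  neg a ⊕ (a ⊕ b)  ≡⟨ ⊕-assoc (neg a) a b ⟨
  (neg a ⊕ a) ⊕ b  ≡⟨ cong (_⊕ b) (trans (⊕-comm (neg a) a) (⊕-inverseʳ a)) ⟩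
  0F ⊕ b           ≡⟨ ⊕-identityˡ b ⟩
  b                ∎
  where open ≡-Reasoning

-- Rotation of the residues by a.
rot : Fin 4 → Permutation′ 4
rot a = permutation (a ⊕_) (neg a ⊕_) (⊕-neg-cancel a) (neg-⊕-cancel a)

-- The residue of a natural number modulo 4.
res : ℕ → Fin 4
res ℕ.zero    = 0F
res (ℕ.suc n) = cyc (res n)

res-+ : ∀ m n → res (m ℕ.+ n) ≡ res n ⊕ res m
res-+ ℕ.zero    n = refl
res-+ (ℕ.suc m) n = trans (cong cyc (res-+ m n)) (sym (⊕-cyc (res n) (res m)))

res-toℕ : ∀ (a : Fin 4) → res (toℕ a) ≡ a
res-toℕ = from-yes (all? λ a → res (toℕ a) Fin.≟ a)

res-*4 : ∀ q n → res (q ℕ.* 4 ℕ.+ n) ≡ res n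
res-*4 ℕ.zero    n = refl
res-*4 (ℕ.suc q) n = trans (cyc⁴ _) (res-*4 q n)

injective : ∀ {n} (π : Permutation′ n) {a b} → π ⟨$⟩ʳ a ≡ π ⟨$⟩ʳ b → a ≡ b
injective π e = trans (sym (inverseˡ π)) (trans (cong (π ⟨$⟩ˡ_) e) (inverseˡ π))

-- Cycles

module CycleLemmas {G : Graph} (C : Cycle G) where
  open Cycle C

  len>0 : 0 ℕ.< len
  len>0 = ℕ.<-≤-trans (ℕ.s≤s ℕ.z≤n) 3≤len

  instance
    len≢0 : NonZero len
    len≢0 = ℕ.>-nonZero len>0

  at-*len : ∀ q i → at (q ℕ.* len ℕ.+ i) ≡ at i
  at-*len ℕ.zero    i = refl
  at-*len (ℕ.suc q) i = begin
    at (len ℕ.+ q ℕ.* len ℕ.+ i)    ≡⟨ cong at (ℕ.+-assoc len (q ℕ.* len) i) ⟩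
    at (len ℕ.+ (q ℕ.* len ℕ.+ i))  ≡⟨ periodic _ ⟩
    at (q ℕ.* len ℕ.+ i)            ≡⟨ at-*len q i ⟩
    at i                            ∎
    where open ≡-Reasoning

  divMod : ∀ i → i ≡ i / len ℕ.* len ℕ.+ i % len
  divMod i = trans (m≡m%n+[m/n]*n i len) (ℕ.+-comm (i % len) _)

  at-% : ∀ i → at (i % len) ≡ at i
  at-% i = sym (trans (cong at (divMod i)) (at-*len (i / len) (i % len)))

  -- A vertex of the cycle determines its position modulo the length.
  at≡⇒%≡ : ∀ {i j} → at i ≡ at j → i % len ≡ j % len
  at≡⇒%≡ {i} {j} e =
    distinct (m%n<n i len) (m%n<n j len) (trans (at-% i) (trans e (sym (at-% j))))

  -- The vertices that follow a given one are determined.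
  at-+ : ∀ {i j} → at i ≡ at j → ∀ n → at (n ℕ.+ i) ≡ at (n ℕ.+ j)
  at-+ {i} {j} e n = begin
    at (n ℕ.+ i)          ≡⟨ reduce i ⟩
    at (n ℕ.+ i % len)    ≡⟨ cong (λ m → at (n ℕ.+ m)) (at≡⇒%≡ {i} {j} e) ⟩
    at (n ℕ.+ j % len)    ≡⟨ reduce j ⟨
    at (n ℕ.+ j)          ∎
    where
    open ≡-Reasoning
    swap-+ : ∀ a b c → a ℕ.+ (b ℕ.+ c) ≡ b ℕ.+ (a ℕ.+ c)
    swap-+ a b c = trans (sym (ℕ.+-assoc a b c))
                         (trans (cong (ℕ._+ c) (ℕ.+-comm a b)) (ℕ.+-assoc b a c))
    reduce : ∀ i → at (n ℕ.+ i) ≡ at (n ℕ.+ i % len)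
    reduce i = begin
      at (n ℕ.+ i)                                  ≡⟨ cong (λ m → at (n ℕ.+ m)) (divMod i) ⟩
      at (n ℕ.+ (i / len ℕ.* len ℕ.+ i % len))      ≡⟨ cong at (swap-+ n (i / len ℕ.* len) (i % len)) ⟩
      at (i / len ℕ.* len ℕ.+ (n ℕ.+ i % len))      ≡⟨ at-*len (i / len) _ ⟩
      at (n ℕ.+ i % len)                            ∎

  -- Any position is reached from any other by walking forwards.
  reach : ∀ i j → ∃[ n ] at (n ℕ.+ i) ≡ at j
  reach i j = n , trans (cong at lemma) (at-*len i j)
    where
    n : ℕ
    -- From position i, i turns less i places lead to position 0, modulo the length.
    n = j ℕ.+ i ℕ.* ℕ.pred len
    lemma : n ℕ.+ i ≡ i ℕ.* len ℕ.+ j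
    lemma = begin
      j ℕ.+ i ℕ.* ℕ.pred len ℕ.+ i      ≡⟨ ℕ.+-assoc j _ i ⟩
      j ℕ.+ (i ℕ.* ℕ.pred len ℕ.+ i)    ≡⟨ cong (j ℕ.+_) (ℕ.+-comm _ i) ⟩
      j ℕ.+ (i ℕ.+ i ℕ.* ℕ.pred len)    ≡⟨ cong (j ℕ.+_) (ℕ.*-suc i (ℕ.pred len)) ⟨
      j ℕ.+ i ℕ.* ℕ.suc (ℕ.pred len)    ≡⟨ cong (λ m → j ℕ.+ i ℕ.* m) (ℕ.suc-pred len) ⟩
      j ℕ.+ i ℕ.* len                   ≡⟨ ℕ.+-comm j _ ⟩
      i ℕ.* len ℕ.+ j                   ∎
      where open ≡-Reasoning

  res-% : 4 ∣ len → ∀ i → res (i % len) ≡ res i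
  res-% (divides q len≡) i = sym (begin
    res i                                             ≡⟨ cong res (divMod i) ⟩
    res (i / len ℕ.* len ℕ.+ i % len)                 ≡⟨ cong (λ m → res (i / len ℕ.* m ℕ.+ i % len)) len≡ ⟩
    res (i / len ℕ.* (q ℕ.* 4) ℕ.+ i % len)           ≡⟨ cong (λ m → res (m ℕ.+ i % len)) (ℕ.*-assoc (i / len) q 4) ⟨
    res (i / len ℕ.* q ℕ.* 4 ℕ.+ i % len)             ≡⟨ res-*4 (i / len ℕ.* q) _ ⟩
    res (i % len)                                     ∎)
    where open ≡-Reasoning

  -- If 4 divides the length, a vertex has a position modulo 4.
  at≡⇒res≡ : 4 ∣ len → ∀ {i j} → at i ≡ at j → res i ≡ res j
  at≡⇒res≡ 4∣len {i} {j} e =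
    trans (sym (res-% 4∣len i)) (trans (cong res (at≡⇒%≡ {i} {j} e)) (res-% 4∣len j))

-- Geometry of the lattice

value-injective : ∀ {A : Set} {P : Pred A 0ℓ} {u v : Refinement A P} → value u ≡ value v → u ≡ v
value-injective refl = refl

_≟ᵥ_ : (p q : ℤ²) → Dec (p ≡ q)
_≟ᵥ_ = ≡-dec ℤ._≟_ ℤ._≟_

side⇒adjacent : ∀ {s u v} → Side s u v → dist² u v ≡ 1ℤ
side⇒adjacent (west {x} {y}) = lemma x y
  where
  lemma : ∀ x y → (x ℤ.- x) ℤ.* (x ℤ.- x) ℤ.+ (y ℤ.- (1ℤ ℤ.+ y)) ℤ.* (y ℤ.- (1ℤ ℤ.+ y)) ≡ 1ℤ
  lemma = solve-∀
side⇒adjacent (north {x} {y}) = lemma x y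
  where
  lemma : ∀ x y → (x ℤ.- (1ℤ ℤ.+ x)) ℤ.* (x ℤ.- (1ℤ ℤ.+ x)) ℤ.+
          ((1ℤ ℤ.+ y) ℤ.- (1ℤ ℤ.+ y)) ℤ.* ((1ℤ ℤ.+ y) ℤ.- (1ℤ ℤ.+ y)) ≡ 1ℤ
  lemma = solve-∀
side⇒adjacent (east {x} {y}) = lemma x y
  where
  lemma : ∀ x y → ((1ℤ ℤ.+ x) ℤ.- (1ℤ ℤ.+ x)) ℤ.* ((1ℤ ℤ.+ x) ℤ.- (1ℤ ℤ.+ x)) ℤ.+
          ((1ℤ ℤ.+ y) ℤ.- y) ℤ.* ((1ℤ ℤ.+ y) ℤ.- y) ≡ 1ℤ
  lemma = solve-∀
side⇒adjacent (south {x} {y}) = lemma x y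
  where
  lemma : ∀ x y → ((1ℤ ℤ.+ x) ℤ.- x) ℤ.* ((1ℤ ℤ.+ x) ℤ.- x) ℤ.+ (y ℤ.- y) ℤ.* (y ℤ.- y) ≡ 1ℤ
  lemma = solve-∀

-- Twice the coordinates of the square on the right of the edge from u to v.
-- Doubling makes this one affine function of u and v for all four directions.
twiceRight : ℤ² → ℤ² → ℤ²
twiceRight (a , b) (a′ , b′) =
  (a ℤ.+ a′ ℤ.+ (b′ ℤ.- b) ℤ.- 1ℤ) , (b ℤ.+ b′ ℤ.- (a′ ℤ.- a) ℤ.- 1ℤ)

side⇒twiceRight : ∀ {s u v} → Side s u v → (+ 2 ℤ.* proj₁ s , + 2 ℤ.* proj₂ s) ≡ twiceRight u v
side⇒twiceRight (west {x} {y}) = cong₂ _,_ (l₁ x y) (l₂ x y)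
  where
  l₁ : ∀ x y → + 2 ℤ.* x ≡ x ℤ.+ x ℤ.+ ((1ℤ ℤ.+ y) ℤ.- y) ℤ.- 1ℤ
  l₁ = solve-∀
  l₂ : ∀ x y → + 2 ℤ.* y ≡ y ℤ.+ (1ℤ ℤ.+ y) ℤ.- (x ℤ.- x) ℤ.- 1ℤ
  l₂ = solve-∀
side⇒twiceRight (north {x} {y}) = cong₂ _,_ (l₁ x y) (l₂ x y)
  where
  l₁ : ∀ x y → + 2 ℤ.* x ≡ x ℤ.+ (1ℤ ℤ.+ x) ℤ.+ ((1ℤ ℤ.+ y) ℤ.- (1ℤ ℤ.+ y)) ℤ.- 1ℤ
  l₁ = solve-∀
  l₂ : ∀ x y → + 2 ℤ.* y ≡ (1ℤ ℤ.+ y) ℤ.+ (1ℤ ℤ.+ y) ℤ.- ((1ℤ ℤ.+ x) ℤ.- x) ℤ.- 1ℤ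
  l₂ = solve-∀
side⇒twiceRight (east {x} {y}) = cong₂ _,_ (l₁ x y) (l₂ x y)
  where
  l₁ : ∀ x y → + 2 ℤ.* x ≡ (1ℤ ℤ.+ x) ℤ.+ (1ℤ ℤ.+ x) ℤ.+ (y ℤ.- (1ℤ ℤ.+ y)) ℤ.- 1ℤ
  l₁ = solve-∀
  l₂ : ∀ x y → + 2 ℤ.* y ≡ (1ℤ ℤ.+ y) ℤ.+ y ℤ.- ((1ℤ ℤ.+ x) ℤ.- (1ℤ ℤ.+ x)) ℤ.- 1ℤ
  l₂ = solve-∀
side⇒twiceRight (south {x} {y}) = cong₂ _,_ (l₁ x y) (l₂ x y)
  where
  l₁ : ∀ x y → + 2 ℤ.* x ≡ (1ℤ ℤ.+ x) ℤ.+ x ℤ.+ (y ℤ.- y) ℤ.- 1ℤ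
  l₁ = solve-∀
  l₂ : ∀ x y → + 2 ℤ.* y ≡ y ℤ.+ y ℤ.- (x ℤ.- (1ℤ ℤ.+ x)) ℤ.- 1ℤ
  l₂ = solve-∀

side-unique : ∀ {s t u v} → Side s u v → Side t u v → s ≡ t
side-unique a b =
  cong₂ _,_ (ℤ.*-cancelˡ-≡ (+ 2) _ _ (cong proj₁ 2s≡2t)) (ℤ.*-cancelˡ-≡ (+ 2) _ _ (cong proj₂ 2s≡2t))
  where 2s≡2t = trans (side⇒twiceRight a) (sym (side⇒twiceRight b))

-- The surroundings of the point p.  The index d runs clockwise through the four
-- directions.  The edge to the neighbour `nb d` separates the square `sq d`,
-- on its left, from the square `sq (cyc d)`, on its right.
record Star (p : ℤ²) : Set where
  field
    nb       : Fin 4 → ℤ²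
    sq       : Fin 4 → Square
    out      : ∀ d → Side (sq (cyc d)) p (nb d)
    inn      : ∀ d → Side (sq d) (nb d) p
    complete : ∀ q → dist² p q ≡ 1ℤ → ∃[ d ] q ≡ nb d
    nb-inj   : ∀ {d e} → nb d ≡ nb e → d ≡ e

square-abs : ∀ a → a ℤ.* a ≡ + (ℤ.∣ a ∣ ℕ.* ℤ.∣ a ∣)
square-abs (+ n)    = sym (ℤ.pos-* n n)
square-abs -[1+ n ] = refl

sumOfSquares≡1 : ∀ m n → m ℕ.* m ℕ.+ n ℕ.* n ≡ 1 → (m ≡ 0 × n ≡ 1) ⊎ (m ≡ 1 × n ≡ 0)
sumOfSquares≡1 0 1 _ = inj₁ (refl , refl)
sumOfSquares≡1 1 0 _ = inj₂ (refl , refl)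
sumOfSquares≡1 0 (ℕ.suc (ℕ.suc n)) ()
sumOfSquares≡1 1 (ℕ.suc n) ()
sumOfSquares≡1 (ℕ.suc (ℕ.suc m)) n ()

abs≡1 : ∀ a → ℤ.∣ a ∣ ≡ 1 → a ≡ 1ℤ ⊎ a ≡ -1ℤ
abs≡1 (+ 1)     refl = inj₁ refl
abs≡1 -[1+ 0 ]  refl = inj₂ refl

-- The steps to the north, east, south and west neighbours.
compass : Fin 4 → ℤ²
compass 0F = 0ℤ , 1ℤ
compass 1F = 1ℤ , 0ℤ
compass 2F = 0ℤ , -1ℤ
compass 3F = -1ℤ , 0ℤ

-- An integer point on the unit circle is a step of the compass.
unitVector : ∀ a b → a ℤ.* a ℤ.+ b ℤ.* b ≡ 1ℤ → ∃[ d ] (a , b) ≡ compass d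
unitVector a b e
  with sumOfSquares≡1 ℤ.∣ a ∣ ℤ.∣ b ∣
         (ℤ.+-injective (trans (sym (cong₂ ℤ._+_ (square-abs a) (square-abs b))) e))
unitVector a b e | inj₁ (a≡0 , b≡1) with ℤ.∣i∣≡0⇒i≡0 {a} a≡0 | abs≡1 b b≡1
... | refl | inj₁ refl = 0F , refl
... | refl | inj₂ refl = 2F , refl
unitVector a b e | inj₂ (a≡1 , b≡0) with abs≡1 a a≡1 | ℤ.∣i∣≡0⇒i≡0 {b} b≡0
... | inj₁ refl | refl = 1F , refl
... | inj₂ refl | refl = 3F , refl

infixl 6 _-ᵥ_
_-ᵥ_ : ℤ² → ℤ² → ℤ²
(a , b) -ᵥ (c , d) = a ℤ.- c , b ℤ.- d

minus-cancelʳ : ∀ a b c → a ℤ.- c ≡ b ℤ.- c → a ≡ b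
minus-cancelʳ a b c = ℤ-Group.∙-cancelʳ (ℤ.- c) a b

-- The star of (x + 1, y + 1).  With this offset no predecessors are needed, so
-- that the four squares, and the sides between them, match definitionally.
star : ∀ x y → Star (ℤ.suc x , ℤ.suc y)
star x y = record
  { nb = nb ; sq = sq ; out = out ; inn = inn ; complete = complete ; nb-inj = nb-inj }
  where
  p : ℤ²
  p = ℤ.suc x , ℤ.suc y

  nb : Fin 4 → ℤ²
  nb 0F = ℤ.suc x , ℤ.suc (ℤ.suc y)
  nb 1F = ℤ.suc (ℤ.suc x) , ℤ.suc y
  nb 2F = ℤ.suc x , y
  nb 3F = x , ℤ.suc y

  sq : Fin 4 → Square
  sq 0F = x , ℤ.suc y
  sq 1F = ℤ.suc x , ℤ.suc y
  sq 2F = ℤ.suc x , y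
  sq 3F = x , y

  out : ∀ d → Side (sq (cyc d)) p (nb d)
  out 0F = west
  out 1F = north
  out 2F = east
  out 3F = south

  inn : ∀ d → Side (sq d) (nb d) p
  inn 0F = east
  inn 1F = south
  inn 2F = west
  inn 3F = north

  -- Only the statements of the following facts matter.
  abstract
    nb-p : ∀ d → nb d -ᵥ p ≡ compass d
    nb-p 0F = cong₂ _,_ (l₁ x) (l₂ y)
      where
      l₁ : ∀ x → (1ℤ ℤ.+ x) ℤ.- (1ℤ ℤ.+ x) ≡ 0ℤ
      l₁ = solve-∀
      l₂ : ∀ x → (1ℤ ℤ.+ (1ℤ ℤ.+ x)) ℤ.- (1ℤ ℤ.+ x) ≡ 1ℤ
      l₂ = solve-∀
    nb-p 1F = cong₂ _,_ (l₁ x) (l₂ y)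
      where
      l₁ : ∀ x → (1ℤ ℤ.+ (1ℤ ℤ.+ x)) ℤ.- (1ℤ ℤ.+ x) ≡ 1ℤ
      l₁ = solve-∀
      l₂ : ∀ x → (1ℤ ℤ.+ x) ℤ.- (1ℤ ℤ.+ x) ≡ 0ℤ
      l₂ = solve-∀
    nb-p 2F = cong₂ _,_ (l₁ x) (l₂ y)
      where
      l₁ : ∀ x → (1ℤ ℤ.+ x) ℤ.- (1ℤ ℤ.+ x) ≡ 0ℤ
      l₁ = solve-∀
      l₂ : ∀ x → x ℤ.- (1ℤ ℤ.+ x) ≡ -1ℤ
      l₂ = solve-∀
    nb-p 3F = cong₂ _,_ (l₁ x) (l₂ y)
      where
      l₁ : ∀ x → x ℤ.- (1ℤ ℤ.+ x) ≡ -1ℤ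
      l₁ = solve-∀
      l₂ : ∀ x → (1ℤ ℤ.+ x) ℤ.- (1ℤ ℤ.+ x) ≡ 0ℤ
      l₂ = solve-∀

    complete : ∀ q → dist² p q ≡ 1ℤ → ∃[ d ] q ≡ nb d
    complete q@(a , b) p~q with unitVector (a ℤ.- ℤ.suc x) (b ℤ.- ℤ.suc y) (trans (dist²-comm q p) p~q)
    ... | d , e = d , cong₂ _,_ (minus-cancelʳ _ _ _ (cong proj₁ q-p≡)) (minus-cancelʳ _ _ _ (cong proj₂ q-p≡))
      where
      q-p≡ : q -ᵥ p ≡ nb d -ᵥ p
      q-p≡ = trans e (sym (nb-p d))

    nb-inj : ∀ {d e} → nb d ≡ nb e → d ≡ e
    nb-inj {d} {e} eq =
      from-yes (all? λ d → all? λ e → (compass d ≟ᵥ compass e) →-dec (d Fin.≟ e)) d e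
        (trans (sym (nb-p d)) (trans (cong (_-ᵥ p) eq) (nb-p e)))

-- Every point is (x + 1, y + 1) for some x and y.
shift : ∀ {ℓ} (P : ℤ² → Set ℓ) → (∀ x y → P (ℤ.suc x , ℤ.suc y)) → ∀ p → P p
shift P h (x , y) =
  subst₂ (λ a b → P (a , b)) (ℤ.suc-pred x) (ℤ.suc-pred y) (h (ℤ.pred x) (ℤ.pred y))

abstract
  starAt : ∀ p → Star p
  starAt = shift Star star

adjacent⇒side : ∀ {p q} → dist² p q ≡ 1ℤ → ∃[ s ] Side s p q
adjacent⇒side {p} {q} p~q = _ , subst (Side _ p) (sym (proj₂ q≡nb)) (Star.out (starAt p) (proj₁ q≡nb))
  where
  q≡nb = Star.complete (starAt p) q p~q

-- Integration over the plane

-- A bi-infinite walk along a relation that is total in both directions.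
module Walk {A : Set} (R : ℤ → Rel A 0ℓ)
  (fore : ∀ x a → ∃[ b ] R x a b) (back : ∀ x b → ∃[ a ] R x a b) (a₀ : A) where

  walk : ℤ → A
  walk (+ 0)            = a₀
  walk (+ ℕ.suc n)      = proj₁ (fore (+ n) (walk (+ n)))
  walk -[1+ 0 ]         = proj₁ (back -[1+ 0 ] a₀)
  walk -[1+ ℕ.suc n ]   = proj₁ (back -[1+ ℕ.suc n ] (walk -[1+ n ]))

  walk-step : ∀ x → R x (walk x) (walk (ℤ.suc x))
  walk-step (+ n)          = proj₂ (fore (+ n) (walk (+ n)))
  walk-step -[1+ 0 ]       = proj₂ (back -[1+ 0 ] a₀)
  walk-step -[1+ ℕ.suc n ] = proj₂ (back -[1+ ℕ.suc n ] (walk -[1+ n ]))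

ℤ-induction : (P : ℤ → Set) → P 0ℤ → (∀ x → P x → P (ℤ.suc x)) → (∀ x → P (ℤ.suc x) → P x) →
              ∀ x → P x
ℤ-induction P p₀ up down (+ 0)          = p₀
ℤ-induction P p₀ up down (+ ℕ.suc n)    = up (+ n) (ℤ-induction P p₀ up down (+ n))
ℤ-induction P p₀ up down -[1+ 0 ]       = down -[1+ 0 ] p₀
ℤ-induction P p₀ up down -[1+ ℕ.suc n ] = down -[1+ ℕ.suc n ] (ℤ-induction P p₀ up down -[1+ n ])

-- Let E relate the values at a square to those at its east neighbour, and N the
-- values at a square to those at its north neighbour, both total in both
-- directions.  If, around every lattice point, the two relations N and either
-- relation E imply the other relation E, there is a family of values on all
-- squares that satisfies every relation: walk along the row y = 0 and then
-- along the columns.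
module Integrate {A : Set} (a₀ : A)
  (E N : ℤ² → Rel A 0ℓ)
  (E-fore : ∀ s a → ∃[ b ] E s a b) (E-back : ∀ s b → ∃[ a ] E s a b)
  (N-fore : ∀ s a → ∃[ b ] N s a b) (N-back : ∀ s b → ∃[ a ] N s a b)
  (flat↑ : ∀ x y {a b c d} → E (x , y) a b → N (x , y) a c → N (ℤ.suc x , y) b d → E (x , ℤ.suc y) c d)
  (flat↓ : ∀ x y {a b c d} → E (x , ℤ.suc y) c d → N (x , y) a c → N (ℤ.suc x , y) b d → E (x , y) a b)
  where

  module Row = Walk (λ x → E (x , 0ℤ)) (λ x → E-fore (x , 0ℤ)) (λ x → E-back (x , 0ℤ)) a₀
  module Column (x : ℤ) =
    Walk (λ y → N (x , y)) (λ y → N-fore (x , y)) (λ y → N-back (x , y)) (Row.walk x)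

  sheet : ℤ² → A
  sheet (x , y) = Column.walk x y

  sheet-N : ∀ x y → N (x , y) (sheet (x , y)) (sheet (x , ℤ.suc y))
  sheet-N x = Column.walk-step x

  sheet-E : ∀ x y → E (x , y) (sheet (x , y)) (sheet (ℤ.suc x , y))
  sheet-E x = ℤ-induction (λ y → E (x , y) (sheet (x , y)) (sheet (ℤ.suc x , y)))
    (Row.walk-step x)
    (λ y e → flat↑ x y e (sheet-N x y) (sheet-N (ℤ.suc x) y))
    (λ y e → flat↓ x y e (sheet-N x y) (sheet-N (ℤ.suc x) y))

-- Four-cycles in efficiently totally coloured graphs

injective⇒bijective : ∀ {n} {f : Fin n → Fin n} → Injective _≡_ _≡_ f → Bijective _≡_ _≡_ f
injective⇒bijective {ℕ.zero} inj = inj , λ ()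
injective⇒bijective {ℕ.suc n} {f} inj = inj , λ y → hit y (any? λ x → f x Fin.≟ y)
  where
  hit : ∀ y → Dec (∃[ x ] f x ≡ y) → ∃[ x ] (∀ {z} → z ≡ x → f z ≡ y)
  hit y (yes (x , fx≡y)) = x , λ { refl → fx≡y }
  hit y (no missed)      = contradiction (Fin.injective⇒≤ punched-injective) ℕ.1+n≰n
    where
    y≢f : ∀ x → y ≢ f x
    y≢f x y≡fx = missed (x , sym y≡fx)
    punched : Fin (ℕ.suc n) → Fin n
    punched x = punchOut (y≢f x)
    punched-injective : Injective _≡_ _≡_ punched
    punched-injective {a} {b} = inj ∘ Fin.punchOut-injective (y≢f a) (y≢f b)

injective₄ : ∀ {A : Set} (f : Fin 4 → A) → f 0F ≢ f 1F → f 1F ≢ f 2F → f 2F ≢ f 3F → f 3F ≢ f 0F →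
             f 0F ≢ f 2F → f 1F ≢ f 3F → Injective _≡_ _≡_ f
injective₄ f ≢01 ≢12 ≢23 ≢30 ≢02 ≢13 {x} {y} = go x y
  where
  go : ∀ x y → f x ≡ f y → x ≡ y
  go 0F 0F _ = refl
  go 0F 1F e = contradiction e ≢01
  go 0F 2F e = contradiction e ≢02
  go 0F 3F e = contradiction (sym e) ≢30
  go 1F 0F e = contradiction (sym e) ≢01
  go 1F 1F _ = refl
  go 1F 2F e = contradiction e ≢12
  go 1F 3F e = contradiction e ≢13
  go 2F 0F e = contradiction (sym e) ≢02
  go 2F 1F e = contradiction (sym e) ≢12
  go 2F 2F _ = refl
  go 2F 3F e = contradiction e ≢23
  go 3F 0F e = contradiction e ≢30
  go 3F 1F e = contradiction (sym e) ≢13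
  go 3F 2F e = contradiction (sym e) ≢23
  go 3F 3F _ = refl

module _ {G : Graph} {μ : Colouring G} (etc : IsETC μ) where
  open Graph G
  open Colouring μ
  open IsETC etc
  open IsTotal total

  edge-cong : ∀ {u v u′ v′} (e : u ~ v) (e′ : u′ ~ v′) → u ≡ u′ → v ≡ v′ → edge u v e ≡ edge u′ v′ e′
  edge-cong _ _ refl refl = refl

  -- On a 4-cycle, consecutive vertices are adjacent and opposite ones lie in
  -- the closed neighbourhood of a third, so the vertex colours are distinct.
  -- Consecutive edges are incident.  The colour of an edge occurs at a vertex
  -- of the cycle, which cannot be an end of that edge; so two opposite edges,
  -- whose ends are all four vertices, cannot share a colour.
  module _ (C : Cycle G) (len≡4 : Cycle.len C ≡ 4) where
    open Cycle C

    wrap : ∀ i → at (4 ℕ.+ i) ≡ at i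
    wrap i = trans (cong (λ n → at (n ℕ.+ i)) (sym len≡4)) (periodic i)

    skip : ∀ i → at i ≢ at (2 ℕ.+ i) → vertexAt μ C i ≢ vertexAt μ C (2 ℕ.+ i)
    skip i i≢i+2 e = i≢i+2 (cong value (proj₁ (efficient (at (1 ℕ.+ i)))
      {at i , [ inj₂ (~-sym (step i)) ]} {at (2 ℕ.+ i) , [ inj₂ (step (1 ℕ.+ i)) ]} e))

    consecutive : ∀ i → vertexAt μ C i ≢ vertexAt μ C (1 ℕ.+ i)
    consecutive i = vertex≢vertex _ _ (step i)

    tail≢ : ∀ i → vertexAt μ C i ≢ edgeAt μ C i
    tail≢ i = vertex≢edge _ _ (step i)

    head≢ : ∀ i → vertexAt μ C (1 ℕ.+ i) ≢ edgeAt μ C i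
    head≢ i e = vertex≢edge _ _ (~-sym (step i)) (trans e (edge-sym _ _ (step i)))

    turn : ∀ i → at i ≢ at (2 ℕ.+ i) → edgeAt μ C i ≢ edgeAt μ C (1 ℕ.+ i)
    turn i i≢i+2 e = edge≢edge _ _ _ (~-sym (step i)) (step (1 ℕ.+ i)) i≢i+2
      (trans (sym (edge-sym _ _ (step i))) e)

    0≢2 : at 0 ≢ at 2
    0≢2 e with distinct (bound 0 (ℕ.s≤s ℕ.z≤n)) (bound 2 (ℕ.s≤s (ℕ.s≤s (ℕ.s≤s ℕ.z≤n)))) e
      where
      bound : ∀ i → i ℕ.< 4 → i ℕ.< len
      bound i = subst (i ℕ.<_) (sym len≡4)
    ... | ()

    1≢3 : at 1 ≢ at 3
    1≢3 e with distinct (bound 1 (ℕ.s≤s (ℕ.s≤s ℕ.z≤n))) (bound 3 ℕ.≤-refl) e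
      where
      bound : ∀ i → i ℕ.< 4 → i ℕ.< len
      bound i = subst (i ℕ.<_) (sym len≡4)
    ... | ()

    vertices-injective : Injective _≡_ _≡_ (λ (i : Fin 4) → vertexAt μ C (toℕ i))
    vertices-injective = injective₄ _ (consecutive 0) (consecutive 1) (consecutive 2)
      (λ e → consecutive 3 (trans e (cong vertex (sym (wrap 0))))) (skip 0 0≢2) (skip 1 1≢3)

    opposite : ∀ (i : Fin 2) → edgeAt μ C (toℕ i) ≢ edgeAt μ C (2 ℕ.+ toℕ i)
    opposite i e with proj₂ (injective⇒bijective vertices-injective) (edgeAt μ C (toℕ i))
    opposite 0F e | 0F , h = tail≢ 0 (h refl)
    opposite 0F e | 1F , h = head≢ 0 (h refl)
    opposite 0F e | 2F , h = tail≢ 2 (trans (h refl) e)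
    opposite 0F e | 3F , h = head≢ 2 (trans (h refl) e)
    opposite 1F e | 0F , h = head≢ 3 (trans (cong vertex (wrap 0)) (trans (h refl) e))
    opposite 1F e | 1F , h = tail≢ 1 (h refl)
    opposite 1F e | 2F , h = head≢ 1 (h refl)
    opposite 1F e | 3F , h = tail≢ 3 (trans (h refl) e)

    edges-injective : Injective _≡_ _≡_ (λ (i : Fin 4) → edgeAt μ C (toℕ i))
    edges-injective = injective₄ _ (turn 0 0≢2) (turn 1 1≢3)
      (turn 2 (λ e → 0≢2 (sym (trans e (wrap 0)))))
      (λ e → turn 3 (λ e′ → 1≢3 (sym (trans e′ (wrap 1))))
        (trans e (edge-cong (step 0) (step 4) (sym (wrap 0)) (sym (wrap 1)))))
      (opposite 0F) (opposite 1F)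

  etc⇒etgc : IsETGC μ
  etc⇒etgc = record
    { etc     = etc
    ; 4-cycle = λ C len≡4 → injective⇒bijective (vertices-injective C len≡4) ,
                            injective⇒bijective (edges-injective C len≡4)
    }

-- The 3-cycle of a vertex

-- Number the places around a vertex p, as seen from a face, by their offset on
-- its belt: p is 0, the next vertex 1, the previous one 3, and the neighbour
-- off the belt 2, since it has the colour of the vertex two places on.  The
-- place k as seen from the face on the left of an edge at p is the place ω k
-- as seen from the face on its right.
ω : Permutation′ 4
ω = permutation f g (from-yes (all? λ x → f (g x) Fin.≟ x)) (from-yes (all? λ x → g (f x) Fin.≟ x))
  where
  f g : Fin 4 → Fin 4
  f 0F = 0F
  f 1F = 2F
  f 2F = 3F
  f 3F = 1F
  g 0F = 0F
  g 1F = 3F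
  g 2F = 1F
  g 3F = 2F

-- The powers of ω with exponent lowered by one, so that 0 stands for ω cubed,
-- the identity.
ω^ : Fin 4 → Permutation′ 4
ω^ 0F = Perm.id
ω^ 1F = Perm.id
ω^ 2F = ω
ω^ 3F = ω ∘ₚ ω

-- The places around p in the squares of its star, when the edge in direction e
-- is missing: `spin e d` translates from a fixed numbering to the one seen
-- from the square d.  It changes by ω across every edge but the missing one.
spin : (e d : Fin 4) → Permutation′ 4
spin e d = ω^ (d ⊕ neg e)

spin-live : ∀ e d → d ≢ e → ∀ k → spin e (cyc d) ⟨$⟩ʳ k ≡ ω ⟨$⟩ʳ (spin e d ⟨$⟩ʳ k)
spin-live = from-yes (all? λ e → all? λ d → ¬? (d Fin.≟ e) →-dec all? λ k →
  spin e (cyc d) ⟨$⟩ʳ k Fin.≟ ω ⟨$⟩ʳ (spin e d ⟨$⟩ʳ k))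

spin-next : ∀ e k → spin e (cyc e) ⟨$⟩ʳ k ≡ k
spin-next = from-yes (all? λ e → all? λ k → spin e (cyc e) ⟨$⟩ʳ k Fin.≟ k)

spin-here : ∀ e k → spin e e ⟨$⟩ʳ k ≡ k
spin-here = from-yes (all? λ e → all? λ k → spin e e ⟨$⟩ʳ k Fin.≟ k)

-- The number, in the fixed numbering, of the place x seen from the square d.
slot : (e d x : Fin 4) → Fin 4
slot e d x = spin e d ⟨$⟩ˡ x

slot-0 : ∀ e d → slot e d 0F ≡ 0F
slot-0 = from-yes (all? λ e → all? λ d → slot e d 0F Fin.≟ 0F)

slot≢0 : ∀ e d x → slot e d (suc x) ≢ 0F
slot≢0 = from-yes (all? λ e → all? λ d → all? λ x → ¬? (slot e d (suc x) Fin.≟ 0F))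

slot-injective : ∀ x e d d′ → d ≢ e → d′ ≢ e → slot e d (suc x) ≡ slot e d′ (suc x) → d ≡ d′
slot-injective = from-yes (all? λ x → all? λ e → all? λ d → all? λ d′ →
  ¬? (d Fin.≟ e) →-dec ¬? (d′ Fin.≟ e) →-dec (slot e d (suc x) Fin.≟ slot e d′ (suc x)) →-dec (d Fin.≟ d′))

slot-surjective : ∀ x e k → k ≢ 0F → ∃[ d ] d ≢ e × slot e d (suc x) ≡ k
slot-surjective = from-yes (all? λ x → all? λ e → all? λ k →
  ¬? (k Fin.≟ 0F) →-dec any? λ d → ¬? (d Fin.≟ e) ×-dec slot e d (suc x) Fin.≟ k)

cyc³≢ : ∀ e → cyc (cyc (cyc e)) ≢ e
cyc³≢ = from-yes (all? λ e → ¬? (cyc (cyc (cyc e)) Fin.≟ e))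

-- Belts of the complementary graph

module Complement (S : Pred ℤ² 0ℓ) (pds : IsPerfectDominating Γ S)
  (isMap : PlanarMap.IsMap S) (4∣belts : PlanarMap.BeltLengthsDivisibleBy S 4) where

  open PlanarMap S
  open Graph Λ using (V)

  -- The points that are vertices of the complementary graph.
  Live : ℤ² → Set
  Live p = p ∉ S

  -- The membership proof in a vertex is irrelevant, but a negation can be
  -- recomputed from an irrelevant proof.
  live : (v : V) → Live (value v)
  live (p , [ l ]) = ¬-recompute l

  vtx : ∀ p → Live p → V
  vtx p l = p , [ l ]

  -- A chosen belt for every square; squares of one face may get belts that
  -- start at different vertices.
  B : Square → Cycle Λ
  B s = proj₁ (isMap s)

  B-belt : ∀ s → IsBelt s (B s)
  B-belt s = proj₂ (isMap s)

  at : Square → ℕ → V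
  at s = Cycle.at (B s)

  pt : Square → ℕ → ℤ²
  pt s i = value (at s i)

  module Bs (s : Square) = CycleLemmas (B s)

  sameRes : ∀ s {i j} → pt s i ≡ pt s j → res i ≡ res j
  sameRes s {i} {j} e = Bs.at≡⇒res≡ s (4∣belts s (B s) (B-belt s)) {i} {j} (value-injective e)

  sameFace-sym : ∀ {s t} → SameFace s t → SameFace t s
  sameFace-sym = Eq.symmetric Merged

  onBelt : ∀ {s t u v} → SameFace s t → Side t u v → Live u → Live v →
           ∃[ i ] pt s i ≡ u × pt s (ℕ.suc i) ≡ v
  onBelt {s} s≈t side lu lv with IsBelt.whole (B-belt s) _ (vtx _ lu) (vtx _ lv) s≈t side
  ... | i , p , q = i , cong value p , cong value q

  locate : ∀ {s t C} → IsBelt s C → SameFace s t → ∀ i →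
           ∃[ j ] Cycle.at C i ≡ at t j × Cycle.at C (ℕ.suc i) ≡ at t (ℕ.suc j)
  locate {t = t} {C} belt s≈t i with IsBelt.bounds belt i
  ... | t′ , s≈t′ , side
    with IsBelt.whole (B-belt t) t′ (Cycle.at C i) (Cycle.at C (ℕ.suc i)) (sameFace-sym s≈t ◅◅ s≈t′) side
  ...   | j , p , q = j , sym p , sym q

  -- Two belts of a face that agree at one position run in step.
  synchronised : ∀ {s t C} → IsBelt s C → SameFace s t → ∀ {i j} → Cycle.at C i ≡ at t j →
                 ∀ n → Cycle.at C (n ℕ.+ i) ≡ at t (n ℕ.+ j)
  synchronised belt s≈t e ℕ.zero = e
  synchronised {t = t} belt s≈t {i} {j} e (ℕ.suc n) with locate belt s≈t (n ℕ.+ i)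
  ... | j′ , p , q =
    trans q (Bs.at-+ t {j′} {n ℕ.+ j} (trans (sym p) (synchronised belt s≈t e n)) 1)

  -- A bijection K from residues to colours colours the positions of a belt.
  infix 7 _⟪_⟫
  _⟪_⟫ : Permutation′ 4 → ℕ → Colour
  K ⟪ i ⟫ = K ⟨$⟩ʳ res i

  -- The colourings K and K′ of the belts of s and t agree, where s is on the
  -- right of the edge from u to v and t on the left.  If u-v is an edge of
  -- the graph, the belt of s passes from u to v and that of t from v to u; the
  -- colours of u and v are exchanged in position, the other two are not.
  -- If u-v is not an edge of the graph, s and t belong to the same face and
  -- the colours must be the same at each vertex.
  record Compatible (s t : Square) (u v : ℤ²) (K K′ : Permutation′ 4) : Set where
    field
      across : ∀ i j → pt s i ≡ u → pt s (ℕ.suc i) ≡ v → pt t j ≡ v → pt t (ℕ.suc j) ≡ u →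
               K ⟪ i ⟫ ≡ K′ ⟪ 1 ℕ.+ j ⟫ × K ⟪ 1 ℕ.+ i ⟫ ≡ K′ ⟪ j ⟫ ×
               K ⟪ 2 ℕ.+ i ⟫ ≡ K′ ⟪ 2 ℕ.+ j ⟫ × K ⟪ 3 ℕ.+ i ⟫ ≡ K′ ⟪ 3 ℕ.+ j ⟫
      within : ¬ (Live u × Live v) → ∀ i j → at s i ≡ at t j → K ⟪ i ⟫ ≡ K′ ⟪ j ⟫
  open Compatible

  compatible-sym : ∀ {s t u v K K′} → Compatible s t u v K K′ → Compatible t s v u K′ K
  across (compatible-sym c) j i a b c′ d with across c i j c′ d a b
  ... | e₀ , e₁ , e₂ , e₃ = sym e₁ , sym e₀ , sym e₂ , sym e₃
  within (compatible-sym c) ¬l j i e = sym (within c (λ (a , b) → ¬l (b , a)) i j (sym e))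

  -- Frames and flatness

  -- For squares of one face, agreement at all vertices amounts to agreement up
  -- to the shift given by one common vertex.
  within⇒frame : ∀ {s t i₀ j₀} {K K′ : Permutation′ 4} → SameFace s t → at s i₀ ≡ at t j₀ →
    (∀ i j → at s i ≡ at t j → K ⟪ i ⟫ ≡ K′ ⟪ j ⟫) →
    ∀ k → K ⟨$⟩ʳ (res i₀ ⊕ k) ≡ K′ ⟨$⟩ʳ (res j₀ ⊕ k)
  within⇒frame {s} {t} {i₀} {j₀} {K} {K′} s≈t e h k =
    trans (cong (K ⟨$⟩ʳ_) (sym (step i₀)))
      (trans (h (toℕ k ℕ.+ i₀) (toℕ k ℕ.+ j₀) (synchronised (B-belt s) s≈t e (toℕ k)))
             (cong (K′ ⟨$⟩ʳ_) (step j₀)))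
    where
    step : ∀ i → res (toℕ k ℕ.+ i) ≡ res i ⊕ k
    step i = trans (res-+ (toℕ k) i) (cong (res i ⊕_) (res-toℕ k))

  frame⇒within : ∀ {s t i₀ j₀} {K K′ : Permutation′ 4} → SameFace s t → at s i₀ ≡ at t j₀ →
    (∀ k → K ⟨$⟩ʳ (res i₀ ⊕ k) ≡ K′ ⟨$⟩ʳ (res j₀ ⊕ k)) →
    ∀ i j → at s i ≡ at t j → K ⟪ i ⟫ ≡ K′ ⟪ j ⟫
  frame⇒within {s} {t} {i₀} {j₀} {K} {K′} s≈t e h i j e′ with Bs.reach s i₀ i
  ... | n , r = begin
    K ⟪ i ⟫                       ≡⟨ cong (K ⟨$⟩ʳ_) (sameRes s (cong value r)) ⟨
    K ⟪ n ℕ.+ i₀ ⟫                ≡⟨ cong (K ⟨$⟩ʳ_) (res-+ n i₀) ⟩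
    K ⟨$⟩ʳ (res i₀ ⊕ res n)       ≡⟨ h (res n) ⟩
    K′ ⟨$⟩ʳ (res j₀ ⊕ res n)      ≡⟨ cong (K′ ⟨$⟩ʳ_) (res-+ n j₀) ⟨
    K′ ⟪ n ℕ.+ j₀ ⟫               ≡⟨ cong (K′ ⟨$⟩ʳ_) (sameRes t (cong value
                                       (trans (sym (synchronised (B-belt s) s≈t e n)) (trans r e′)))) ⟩
    K′ ⟪ j ⟫                      ∎
    where open ≡-Reasoning

  -- Across an edge of the graph, with positions counted from u, compatibility
  -- is equality up to ω.
  across⇒frame : ∀ {s t u v i j K K′} →
    pt s i ≡ u → pt s (ℕ.suc i) ≡ v → pt t j ≡ v → pt t (ℕ.suc j) ≡ u →
    Compatible s t u v K K′ →
    ∀ k → K ⟨$⟩ʳ (res i ⊕ (ω ⟨$⟩ʳ k)) ≡ K′ ⟨$⟩ʳ (res (ℕ.suc j) ⊕ k)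
  across⇒frame {i = i} {j} {K} {K′} a b c d comp k with across comp i j a b c d | k
  ... | e₀ , e₁ , e₂ , e₃ | 0F = e₀
  ... | e₀ , e₁ , e₂ , e₃ | 1F = e₂
  ... | e₀ , e₁ , e₂ , e₃ | 2F = e₃
  ... | e₀ , e₁ , e₂ , e₃ | 3F = trans e₁ (cong (K′ ⟨$⟩ʳ_) (sym (cyc⁴ (res j))))

  frame⇒across : ∀ {s t u v i j} {K K′ : Permutation′ 4} → Live u → Live v →
    pt s i ≡ u → pt s (ℕ.suc i) ≡ v → pt t j ≡ v → pt t (ℕ.suc j) ≡ u →
    (∀ k → K ⟨$⟩ʳ (res i ⊕ (ω ⟨$⟩ʳ k)) ≡ K′ ⟨$⟩ʳ (res (ℕ.suc j) ⊕ k)) →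
    Compatible s t u v K K′
  within (frame⇒across lu lv _ _ _ _ h) ¬l = contradiction (lu , lv) ¬l
  across (frame⇒across {s} {t} {i = i} {j} {K} {K′} lu lv a b c d h) i′ j′ a′ b′ c′ d′
    rewrite sameRes s {i′} {i} (trans a′ (sym a)) | sameRes t {j′} {j} (trans c′ (sym c)) =
    h 0F , trans (h 3F) (cong (K′ ⟨$⟩ʳ_) (cyc⁴ (res j))) , h 1F , h 2F

  -- Parametrisations P d of the residues of the four squares around p, in which
  -- compatibility across every edge at p, missing or not, is equality.
  record Frame {p} (st : Star p) : Set where
    open Star st
    field
      P    : Fin 4 → Permutation′ 4
      to   : ∀ d {K K′} → Compatible (sq (cyc d)) (sq d) p (nb d) K K′ →
             ∀ k → K ⟨$⟩ʳ (P (cyc d) ⟨$⟩ʳ k) ≡ K′ ⟨$⟩ʳ (P d ⟨$⟩ʳ k)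
      from : ∀ d {K K′ : Permutation′ 4} →
             (∀ k → K ⟨$⟩ʳ (P (cyc d) ⟨$⟩ʳ k) ≡ K′ ⟨$⟩ʳ (P d ⟨$⟩ʳ k)) →
             Compatible (sq (cyc d)) (sq d) p (nb d) K K′

  -- Around a deleted point all four squares belong to one face, and positions
  -- are counted from a common vertex of their belts.
  module DeadPoint {p} (st : Star p) (dead : ¬ Live p) where
    open Star st

    merged : ∀ d → SameFace (sq (cyc d)) (sq d)
    merged d = fwd (_ , _ , out d , inn d , λ (l , _) → dead l) ◅ ε

    merged₀ : ∀ d → SameFace (sq 0F) (sq d)
    merged₀ 0F = ε
    merged₀ 3F = merged 3F
    merged₀ 2F = merged 3F ◅◅ merged 2F
    merged₀ 1F = merged 3F ◅◅ merged 2F ◅◅ merged 1F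

    pos : Fin 4 → ℕ
    pos d = proj₁ (locate (B-belt (sq 0F)) (merged₀ d) 0)

    pos-at : ∀ d → at (sq 0F) 0 ≡ at (sq d) (pos d)
    pos-at d = proj₁ (proj₂ (locate (B-belt (sq 0F)) (merged₀ d) 0))

    meet : ∀ d → at (sq (cyc d)) (pos (cyc d)) ≡ at (sq d) (pos d)
    meet d = trans (sym (pos-at (cyc d))) (pos-at d)

    frame : Frame st
    frame = record
      { P    = λ d → rot (res (pos d))
      ; to   = λ d {K} {K′} c → within⇒frame {K = K} {K′} (merged d) (meet d) (within c (dead ∘ proj₁))
      ; from = λ d {K} {K′} h → record
        { across = λ i j i≡p → contradiction (subst Live i≡p (live (at (sq (cyc d)) i))) dead
        ; within = λ _ → frame⇒within {K = K} {K′} (merged d) (meet d) h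
        }
      }

  -- Around a vertex, the direction e of its only deleted neighbour is the only
  -- one whose edge is missing.  All four belts pass through the vertex, and
  -- positions are counted from there.
  module LivePoint {p} (st : Star p) (l : Live p) where
    open Star st

    e : Fin 4
    e = proj₁ (complete _ (proj₂ (proj₁ (proj₂ (pds p l)))))

    nb-e-dead : ¬ Live (nb e)
    nb-e-dead nl with pds p l
    ... | u , (u∈S , p~u) , unique with complete u p~u
    ...   | d , refl = nl u∈S

    nb-live : ∀ d → d ≢ e → Live (nb d)
    nb-live d d≢e nb∈S with pds p l
    ... | u , (u∈S , p~u) , unique with complete u p~u
    ...   | d′ , u≡ = d≢e (nb-inj (trans (sym (unique (nb∈S , side⇒adjacent (out d)))) u≡))

    incoming : ∀ d → d ≢ e → ∃[ j ] pt (sq d) j ≡ nb d × pt (sq d) (ℕ.suc j) ≡ p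
    incoming d d≢e = onBelt ε (inn d) (nb-live d d≢e) l

    outgoing : ∀ d → d ≢ e → ∃[ i ] pt (sq (cyc d)) i ≡ p × pt (sq (cyc d)) (ℕ.suc i) ≡ nb d
    outgoing d d≢e = onBelt ε (out d) l (nb-live d d≢e)

    hub : ∀ d → ∃[ i ] pt (sq d) i ≡ p
    hub d with d Fin.≟ e
    ... | no d≢e = _ , proj₂ (proj₂ (incoming d d≢e))
    -- The belt of sq e does not enter p along the missing edge e, but it leaves
    -- along the edge of the preceding direction.
    ... | yes refl = subst (λ d → ∃[ i ] pt (sq d) i ≡ p) (cyc⁴ e)
                       (_ , proj₁ (proj₂ (outgoing (cyc (cyc (cyc e))) (cyc³≢ e))))

    pos : Fin 4 → ℕ
    pos d = proj₁ (hub d)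

    pos-at : ∀ d → pt (sq d) (pos d) ≡ p
    pos-at d = proj₂ (hub d)

    P : Fin 4 → Permutation′ 4
    P d = spin e d ∘ₚ rot (res (pos d))

    merged : SameFace (sq (cyc e)) (sq e)
    merged = fwd (_ , _ , out e , inn e , λ (_ , nl) → nb-e-dead nl) ◅ ε

    meet : at (sq (cyc e)) (pos (cyc e)) ≡ at (sq e) (pos e)
    meet = value-injective (trans (pos-at (cyc e)) (sym (pos-at e)))

    out-res : ∀ d d≢e → res (proj₁ (outgoing d d≢e)) ≡ res (pos (cyc d))
    out-res d d≢e = sameRes (sq (cyc d)) (trans (proj₁ (proj₂ (outgoing d d≢e))) (sym (pos-at (cyc d))))

    inn-res : ∀ d d≢e → res (ℕ.suc (proj₁ (incoming d d≢e))) ≡ res (pos d)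
    inn-res d d≢e = sameRes (sq d) (trans (proj₂ (proj₂ (incoming d d≢e))) (sym (pos-at d)))

    module _ (d : Fin 4) {K K′ : Permutation′ 4} where

      to : Dec (d ≡ e) → Compatible (sq (cyc d)) (sq d) p (nb d) K K′ →
           ∀ k → K ⟨$⟩ʳ (P (cyc d) ⟨$⟩ʳ k) ≡ K′ ⟨$⟩ʳ (P d ⟨$⟩ʳ k)
      to (yes refl) c k = trans (cong (λ x → K ⟨$⟩ʳ (res (pos (cyc e)) ⊕ x)) (trans (spin-next e k) (sym (spin-here e k))))
        (within⇒frame {K = K} {K′} merged meet (within c (nb-e-dead ∘ proj₂)) (spin e e ⟨$⟩ʳ k))
      to (no d≢e) c k = begin
        K ⟨$⟩ʳ (res (pos (cyc d)) ⊕ (spin e (cyc d) ⟨$⟩ʳ k))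
          ≡⟨ cong₂ (λ r x → K ⟨$⟩ʳ (r ⊕ x)) (sym (out-res d d≢e)) (spin-live e d d≢e k) ⟩
        K ⟨$⟩ʳ (res (proj₁ o) ⊕ (ω ⟨$⟩ʳ (spin e d ⟨$⟩ʳ k)))
          ≡⟨ across⇒frame (proj₁ (proj₂ o)) (proj₂ (proj₂ o)) (proj₁ (proj₂ i)) (proj₂ (proj₂ i)) c (spin e d ⟨$⟩ʳ k) ⟩
        K′ ⟨$⟩ʳ (res (ℕ.suc (proj₁ i)) ⊕ (spin e d ⟨$⟩ʳ k))
          ≡⟨ cong (λ r → K′ ⟨$⟩ʳ (r ⊕ (spin e d ⟨$⟩ʳ k))) (inn-res d d≢e) ⟩
        K′ ⟨$⟩ʳ (res (pos d) ⊕ (spin e d ⟨$⟩ʳ k))  ∎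
        where
        open ≡-Reasoning
        o = outgoing d d≢e
        i = incoming d d≢e

      from : Dec (d ≡ e) → (∀ k → K ⟨$⟩ʳ (P (cyc d) ⟨$⟩ʳ k) ≡ K′ ⟨$⟩ʳ (P d ⟨$⟩ʳ k)) →
             Compatible (sq (cyc d)) (sq d) p (nb d) K K′
      from (yes refl) h = record
        { across = λ i j _ i≡nb → contradiction (subst Live i≡nb (live (at (sq (cyc d)) (ℕ.suc i)))) nb-e-dead
        ; within = λ _ → frame⇒within {K = K} {K′} merged meet λ k →
            trans (cong (λ x → K ⟨$⟩ʳ (res (pos (cyc e)) ⊕ x)) (sym (spin-next e k)))
              (trans (h k) (cong (λ x → K′ ⟨$⟩ʳ (res (pos e) ⊕ x)) (spin-here e k)))
        }
      from (no d≢e) h = frame⇒across {K = K} {K′} l (nb-live d d≢e)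
        (proj₁ (proj₂ o)) (proj₂ (proj₂ o)) (proj₁ (proj₂ i)) (proj₂ (proj₂ i)) λ k →
        let k′ = spin e d ⟨$⟩ˡ k
            spin-k′ : spin e d ⟨$⟩ʳ k′ ≡ k
            spin-k′ = inverseʳ (spin e d)
        in begin
        K ⟨$⟩ʳ (res (proj₁ o) ⊕ (ω ⟨$⟩ʳ k))
          ≡⟨ cong₂ (λ r x → K ⟨$⟩ʳ (r ⊕ x)) (out-res d d≢e)
               (trans (cong (ω ⟨$⟩ʳ_) (sym spin-k′)) (sym (spin-live e d d≢e k′))) ⟩
        K ⟨$⟩ʳ (P (cyc d) ⟨$⟩ʳ k′)
          ≡⟨ h k′ ⟩
        K′ ⟨$⟩ʳ (P d ⟨$⟩ʳ k′)
          ≡⟨ cong₂ (λ r x → K′ ⟨$⟩ʳ (r ⊕ x)) (sym (inn-res d d≢e)) spin-k′ ⟩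
        K′ ⟨$⟩ʳ (res (ℕ.suc (proj₁ i)) ⊕ k)  ∎
        where
        open ≡-Reasoning
        o = outgoing d d≢e
        i = incoming d d≢e

    frame : Frame st
    frame = record { P = P ; to = λ d → to d (d Fin.≟ e) ; from = λ d → from d (d Fin.≟ e) }

  -- Being a vertex is decidable: a vertex lies on the belt of each of the four
  -- squares around it, a deleted point on none, and a belt is finite.
  live? : ∀ p → Dec (Live p)
  live? p = map′
    (λ (i , i≡p) → subst Live i≡p (live (at s (toℕ i))))
    (λ l → let i = LivePoint.hub st l 0F in
           fromℕ< (m%n<n (proj₁ i) (Cycle.len (B s))) ,
           trans (cong (pt s) (toℕ-fromℕ< _)) (trans (cong value (Bs.at-% s (proj₁ i))) (proj₂ i)))
    (any? λ (i : Fin (Cycle.len (B s))) → pt s (toℕ i) ≟ᵥ p)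
    where
    st = starAt p
    s  = Star.sq st 0F
    instance
      len≢0 : NonZero (Cycle.len (B s))
      len≢0 = Bs.len≢0 s

  abstract
    frame : ∀ {p} (st : Star p) → Frame st
    frame {p} st with live? p
    ... | yes l = LivePoint.frame st l
    ... | no ¬l = DeadPoint.frame st ¬l

  -- The coherent family of face colourings

  module _ {p} (st : Star p) (d : Fin 4) where
    open Star st
    open Frame (frame st)

    extend-left : ∀ K → ∃[ K′ ] Compatible (sq (cyc d)) (sq d) p (nb d) K K′
    extend-left K = Perm.flip (P d) ∘ₚ P (cyc d) ∘ₚ K ,
      from d λ k → cong (λ x → K ⟨$⟩ʳ (P (cyc d) ⟨$⟩ʳ x)) (sym (inverseˡ (P d)))

    extend-right : ∀ K′ → ∃[ K ] Compatible (sq (cyc d)) (sq d) p (nb d) K K′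
    extend-right K′ = Perm.flip (P (cyc d)) ∘ₚ P d ∘ₚ K′ ,
      from d λ k → cong (λ x → K′ ⟨$⟩ʳ (P d ⟨$⟩ʳ x)) (inverseˡ (P (cyc d)))

  -- Compatibility of a square with its east and north neighbours.
  E N : ℤ² → Rel (Permutation′ 4) 0ℓ
  E (x , y) K K′ = Compatible (x , y) (ℤ.suc x , y) (ℤ.suc x , ℤ.suc y) (ℤ.suc x , y) K K′
  N (x , y) K K′ = Compatible (x , ℤ.suc y) (x , y) (ℤ.suc x , ℤ.suc y) (x , ℤ.suc y) K′ K

  -- Flatness: compatibility across three of the edges at a point implies
  -- compatibility across the fourth.
  flat↑ : ∀ x y {a b c d} → E (x , y) a b → N (x , y) a c → N (ℤ.suc x , y) b d → E (x , ℤ.suc y) c d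
  flat↑ x y {a} {b} {c} {d} ab ac bd = compatible-sym (from 0F λ k → sym (begin
    c ⟨$⟩ʳ (P 0F ⟨$⟩ʳ k)  ≡⟨ to 3F ac k ⟩
    a ⟨$⟩ʳ (P 3F ⟨$⟩ʳ k)  ≡⟨ to 2F ab k ⟩
    b ⟨$⟩ʳ (P 2F ⟨$⟩ʳ k)  ≡⟨ to 1F (compatible-sym bd) k ⟩
    d ⟨$⟩ʳ (P 1F ⟨$⟩ʳ k)  ∎))
    where
    open ≡-Reasoning
    open Frame (frame (star x y))

  flat↓ : ∀ x y {a b c d} → E (x , ℤ.suc y) c d → N (x , y) a c → N (ℤ.suc x , y) b d → E (x , y) a b
  flat↓ x y {a} {b} {c} {d} cd ac bd = from 2F λ k → begin
    a ⟨$⟩ʳ (P 3F ⟨$⟩ʳ k)  ≡⟨ to 3F ac k ⟨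
    c ⟨$⟩ʳ (P 0F ⟨$⟩ʳ k)  ≡⟨ to 0F (compatible-sym cd) k ⟨
    d ⟨$⟩ʳ (P 1F ⟨$⟩ʳ k)  ≡⟨ to 1F (compatible-sym bd) k ⟨
    b ⟨$⟩ʳ (P 2F ⟨$⟩ʳ k)  ∎
    where
    open ≡-Reasoning
    open Frame (frame (star x y))

  open Integrate Perm.id E N
    (λ (x , y) → extend-left (star x y) 2F) (λ (x , y) → extend-right (star x y) 2F)
    (λ (x , y) → extend-right (star x y) 3F) (λ (x , y) → extend-left (star x y) 3F)
    flat↑ flat↓
    using (sheet; sheet-E; sheet-N)

  abstract
    -- The colouring of the belt of every square.
    K : Square → Permutation′ 4
    K = sheet

    coherent-star : ∀ x y (let open Star (star x y)) d →
      Compatible (sq (cyc d)) (sq d) (ℤ.suc x , ℤ.suc y) (nb d) (K (sq (cyc d))) (K (sq d))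
    coherent-star x y 0F = compatible-sym (sheet-E x (ℤ.suc y))
    coherent-star x y 1F = compatible-sym (sheet-N (ℤ.suc x) y)
    coherent-star x y 2F = sheet-E x y
    coherent-star x y 3F = sheet-N x y

  coherent : ∀ {s t u v} → Side s u v → Side t v u → Compatible s t u v (K s) (K t)
  coherent {s} {t} {u} {v} right left =
    shift (λ u → ∀ {s t v} → Side s u v → Side t v u → Compatible s t u v (K s) (K t)) at-star u right left
    where
    at-star : ∀ x y {s t v} → Side s (ℤ.suc x , ℤ.suc y) v → Side t v (ℤ.suc x , ℤ.suc y) →
              Compatible s t (ℤ.suc x , ℤ.suc y) v (K s) (K t)
    at-star x y {v = v} right left with Star.complete (star x y) v (side⇒adjacent right)
    ... | d , refl with side-unique right (Star.out (star x y) d) | side-unique left (Star.inn (star x y) d)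
    ...   | refl | refl = coherent-star x y d

  -- The colouring

  -- The colour of a vertex on the belt of a face does not depend on the square
  -- by which the face is named.
  sameFace-colour : ∀ {s t i j} → SameFace s t → at s i ≡ at t j → K s ⟪ i ⟫ ≡ K t ⟪ j ⟫
  sameFace-colour {s} ε e = cong (K s ⟨$⟩ʳ_) (sameRes s (cong value e))
  sameFace-colour {s} {i = i} (m ◅ rest) e with locate (B-belt s) (m ◅ ε) i
  ... | j , p , _ = trans (step m p) (sameFace-colour rest (trans (sym p) e))
    where
    step : ∀ {s t i j} → SymClosure Merged s t → at s i ≡ at t j → K s ⟪ i ⟫ ≡ K t ⟪ j ⟫
    step (fwd (_ , _ , right , left , ¬l)) p = within (coherent right left) ¬l _ _ p
    step (bwd (_ , _ , right , left , ¬l)) p = sym (within (coherent right left) ¬l _ _ (sym p))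

  -- The colours around the vertex p in the fixed numbering of its places.
  module Picture {p} (st : Star p) (l : Live p) where
    open Star st
    open LivePoint st l public

    κ : Permutation′ 4
    κ = P 0F ∘ₚ K (sq 0F)

    κ-step : ∀ d k → K (sq (cyc d)) ⟨$⟩ʳ (P (cyc d) ⟨$⟩ʳ k) ≡ K (sq d) ⟨$⟩ʳ (P d ⟨$⟩ʳ k)
    κ-step d = to d (d Fin.≟ e) (coherent (out d) (inn d))

    κ-sq : ∀ d k → K (sq d) ⟨$⟩ʳ (P d ⟨$⟩ʳ k) ≡ κ ⟨$⟩ʳ k
    κ-sq 0F k = refl
    κ-sq 1F k = κ-step 0F k
    κ-sq 2F k = trans (κ-step 1F k) (κ-step 0F k)
    κ-sq 3F k = trans (κ-step 2F k) (trans (κ-step 1F k) (κ-step 0F k))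

    reading : ∀ d x → K (sq d) ⟨$⟩ʳ (res (pos d) ⊕ x) ≡ κ ⟨$⟩ʳ slot e d x
    reading d x = trans (cong (λ y → K (sq d) ⟨$⟩ʳ (res (pos d) ⊕ y)) (sym (inverseʳ (spin e d))))
                        (κ-sq d (slot e d x))

    centre : ∀ d → K (sq d) ⟪ pos d ⟫ ≡ κ ⟨$⟩ʳ 0F
    centre d = trans (reading d 0F) (cong (κ ⟨$⟩ʳ_) (slot-0 e d))

  -- The colour of a vertex on the belt of one of the squares around it;
  -- by `vertexColour-at` any belt through the vertex gives the same.
  vertexColour : V → Colour
  vertexColour v = K (Star.sq st 0F) ⟪ LivePoint.pos st (live v) 0F ⟫
    where st = starAt (value v)

  vertexColour-at : ∀ s i → vertexColour (at s i) ≡ K s ⟪ i ⟫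
  vertexColour-at s i = begin
    K (sq 0F) ⟪ pos 0F ⟫                ≡⟨ trans (centre 0F) (sym (centre (cyc d))) ⟩
    K (sq (cyc d)) ⟪ pos (cyc d) ⟫      ≡⟨ sameFace-colour
                                             (subst (SameFace s) (side-unique side (subst (Side _ _) (sym q≡nb) (out d))) s≈t)
                                             (value-injective (sym (pos-at (cyc d)))) ⟨
    K s ⟪ i ⟫                           ∎
    where
    open ≡-Reasoning
    open Star (starAt (pt s i))
    open Picture (starAt (pt s i)) (live (at s i))
    bound = IsBelt.bounds (B-belt s) i
    s≈t   = proj₁ (proj₂ bound)
    side  = proj₂ (proj₂ bound)
    q     = complete (pt s (ℕ.suc i)) (side⇒adjacent side)
    d     = proj₁ q
    q≡nb  = proj₂ q

  -- The sense of the edge colouring: directed or reversed.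
  data Sense : Set where
    direct reverse : Sense

  -- The edge after position i gets the colour of position i + 3, that is of
  -- i - 1, in the directed colouring, and of position i + 2 in the reversed one.
  lag : Sense → ℕ
  lag direct  = 3
  lag reverse = 2

  module _ (σ : Sense) where

    module _ (u v : V) .(u~v : dist² (value u) (value v) ≡ 1ℤ) where

      rightSquare : ∃[ s ] Side s (value u) (value v)
      rightSquare = adjacent⇒side (recompute (_ ℤ.≟ _) u~v)

      onRight : ∃[ i ] pt (proj₁ rightSquare) i ≡ value u × pt (proj₁ rightSquare) (ℕ.suc i) ≡ value v
      onRight = onBelt ε (proj₂ rightSquare) (live u) (live v)

      edgeColour : Colour
      edgeColour = K (proj₁ rightSquare) ⟪ lag σ ℕ.+ proj₁ onRight ⟫

    edgeColour-at : ∀ {u v} s i → at s i ≡ u → at s (ℕ.suc i) ≡ v → .(u~v : dist² (value u) (value v) ≡ 1ℤ) →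
                    edgeColour u v u~v ≡ K s ⟪ lag σ ℕ.+ i ⟫
    edgeColour-at {u} {v} s i refl refl u~v =
      sym (sameFace-colour s≈r (synchronised (B-belt s) s≈r (value-injective (sym (proj₁ (proj₂ (onRight u v u~v))))) (lag σ)))
      where
      bound = IsBelt.bounds (B-belt s) i
      s≈r : SameFace s (proj₁ (rightSquare u v u~v))
      s≈r = subst (SameFace s) (side-unique (proj₂ (proj₂ bound)) (proj₂ (rightSquare u v u~v))) (proj₁ (proj₂ bound))

    -- Both offsets are among those at which the two faces of an edge agree.
    edgeColour-sym : ∀ u v .(u~v : dist² (value u) (value v) ≡ 1ℤ) .(v~u : dist² (value v) (value u) ≡ 1ℤ) →
                     edgeColour u v u~v ≡ edgeColour v u v~u
    edgeColour-sym u v u~v v~u = choose σ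
      where
      i = onRight u v u~v
      j = onRight v u v~u
      eqs = across (coherent (proj₂ (rightSquare u v u~v)) (proj₂ (rightSquare v u v~u))) (proj₁ i) (proj₁ j)
              (proj₁ (proj₂ i)) (proj₂ (proj₂ i)) (proj₁ (proj₂ j)) (proj₂ (proj₂ j))
      choose : ∀ σ → K (proj₁ (rightSquare u v u~v)) ⟪ lag σ ℕ.+ proj₁ i ⟫ ≡ K (proj₁ (rightSquare v u v~u)) ⟪ lag σ ℕ.+ proj₁ j ⟫
      choose direct  = proj₂ (proj₂ (proj₂ eqs))
      choose reverse = proj₁ (proj₂ (proj₂ eqs))

    μ : Colouring Λ
    μ = record
      { vertex   = vertexColour
      ; edge     = edgeColour
      ; edge-sym = λ u v u~v → edgeColour-sym u v u~v (Graph.~-sym Λ {u} {v} u~v)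
      }

  -- The lag counted from the second end of the edge is `suc (edgeSlot σ)`.
  edgeSlot : Sense → Fin 3
  edgeSlot direct  = 1F
  edgeSlot reverse = 0F

  lag-res : ∀ σ j → res (lag σ ℕ.+ j) ≡ res (ℕ.suc j) ⊕ suc (edgeSlot σ)
  lag-res direct  j = refl
  lag-res reverse j = refl

  -- The colours of a vertex, its neighbours and its edges.  An edge is read on
  -- the face on its left, whose belt runs along it towards u.
  module Around (u : V) where
    open Star (starAt (value u))
    open Picture (starAt (value u)) (live u) hiding (to; from)
    open Graph Λ using (_~_)

    vertex-centre : vertexColour u ≡ κ ⟨$⟩ʳ 0F
    vertex-centre = centre 0F

    towards : ∀ v → u ~ v → ∃[ d ] d ≢ e × value v ≡ nb d
    towards v u~v with complete (value v) u~v
    ... | d , v≡nb = d , (λ { refl → nb-e-dead (subst Live v≡nb (live v)) }) , v≡nb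

    neighbour : ∀ d → d ≢ e → V
    neighbour d d≢e = vtx (nb d) (nb-live d d≢e)

    u~neighbour : ∀ d d≢e → u ~ neighbour d d≢e
    u~neighbour d d≢e = side⇒adjacent (out d)

    vertex-neighbour : ∀ v d → d ≢ e → value v ≡ nb d → vertexColour v ≡ κ ⟨$⟩ʳ slot e d 3F
    vertex-neighbour v d d≢e v≡nb = begin
      vertexColour v                        ≡⟨ cong vertexColour (value-injective {u = v} {at (sq d) j} (trans v≡nb (sym j≡nb))) ⟩
      vertexColour (at (sq d) j)            ≡⟨ vertexColour-at (sq d) j ⟩
      K (sq d) ⟪ j ⟫                        ≡⟨ cong (K (sq d) ⟨$⟩ʳ_) (cyc⁴ (res j)) ⟨
      K (sq d) ⟨$⟩ʳ (cyc (res j) ⊕ 3F)      ≡⟨ cong (λ r → K (sq d) ⟨$⟩ʳ (r ⊕ 3F)) (inn-res d d≢e) ⟩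
      K (sq d) ⟨$⟩ʳ (res (pos d) ⊕ 3F)      ≡⟨ reading d 3F ⟩
      κ ⟨$⟩ʳ slot e d 3F                    ∎
      where
      open ≡-Reasoning
      j    = proj₁ (incoming d d≢e)
      j≡nb = proj₁ (proj₂ (incoming d d≢e))

    edge-towards : ∀ σ v d → d ≢ e → value v ≡ nb d → .(u~v : u ~ v) →
                   edgeColour σ u v u~v ≡ κ ⟨$⟩ʳ slot e d (suc (edgeSlot σ))
    edge-towards σ v d d≢e v≡nb u~v = begin
      edgeColour σ u v u~v
        ≡⟨ edgeColour-sym σ u v u~v (Graph.~-sym Λ {u} {v} u~v) ⟩
      edgeColour σ v u (Graph.~-sym Λ {u} {v} u~v)
        ≡⟨ edgeColour-at σ (sq d) j (value-injective {u = at (sq d) j} {v} (trans j≡nb (sym v≡nb)))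
             (value-injective {u = at (sq d) (ℕ.suc j)} {u} j+1≡p)
             (Graph.~-sym Λ {u} {v} u~v) ⟩
      K (sq d) ⟪ lag σ ℕ.+ j ⟫
        ≡⟨ cong (K (sq d) ⟨$⟩ʳ_) (trans (lag-res σ j) (cong (_⊕ suc (edgeSlot σ)) (inn-res d d≢e))) ⟩
      K (sq d) ⟨$⟩ʳ (res (pos d) ⊕ suc (edgeSlot σ))
        ≡⟨ reading d (suc (edgeSlot σ)) ⟩
      κ ⟨$⟩ʳ slot e d (suc (edgeSlot σ))  ∎
      where
      open ≡-Reasoning
      j     = proj₁ (incoming d d≢e)
      j≡nb  = proj₁ (proj₂ (incoming d d≢e))
      j+1≡p = proj₂ (proj₂ (incoming d d≢e))

    slot-colour≢ : ∀ d x → κ ⟨$⟩ʳ 0F ≢ κ ⟨$⟩ʳ slot e d (suc x)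
    slot-colour≢ d x eq = slot≢0 e d x (sym (injective κ eq))

    vertex≢neighbour : ∀ v → u ~ v → vertexColour u ≢ vertexColour v
    vertex≢neighbour v u~v eq with towards v u~v
    ... | d , d≢e , v≡nb =
      slot-colour≢ d 2F (trans (sym vertex-centre) (trans eq (vertex-neighbour v d d≢e v≡nb)))

    vertex≢edge : ∀ σ v (u~v : u ~ v) → vertexColour u ≢ edgeColour σ u v u~v
    vertex≢edge σ v u~v eq with towards v u~v
    ... | d , d≢e , v≡nb =
      slot-colour≢ d (edgeSlot σ) (trans (sym vertex-centre) (trans eq (edge-towards σ v d d≢e v≡nb u~v)))

    edge≢edge : ∀ σ v w (u~v : u ~ v) (u~w : u ~ w) → v ≢ w → edgeColour σ u v u~v ≢ edgeColour σ u w u~w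
    edge≢edge σ v w u~v u~w v≢w eq with towards v u~v | towards w u~w
    ... | d , d≢e , v≡nb | d′ , d′≢e , w≡nb = v≢w (value-injective (begin
      value v  ≡⟨ v≡nb ⟩
      nb d     ≡⟨ cong nb (slot-injective (edgeSlot σ) e d d′ d≢e d′≢e (injective κ (begin
                    κ ⟨$⟩ʳ slot e d (suc (edgeSlot σ))   ≡⟨ edge-towards σ v d d≢e v≡nb u~v ⟨
                    edgeColour σ u v u~v                 ≡⟨ eq ⟩
                    edgeColour σ u w u~w                 ≡⟨ edge-towards σ w d′ d′≢e w≡nb u~w ⟩
                    κ ⟨$⟩ʳ slot e d′ (suc (edgeSlot σ))  ∎))) ⟩
      nb d′    ≡⟨ w≡nb ⟨
      value w  ∎))
      where open ≡-Reasoning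

    nbhd-injective : ∀ {v w} → ClosedNbr Λ u v → ClosedNbr Λ u w → vertexColour v ≡ vertexColour w → v ≡ w
    nbhd-injective (inj₁ refl) (inj₁ refl) eq = refl
    nbhd-injective {w = w} (inj₁ refl) (inj₂ u~w) eq = contradiction eq (vertex≢neighbour w u~w)
    nbhd-injective {v} (inj₂ u~v) (inj₁ refl) eq = contradiction (sym eq) (vertex≢neighbour v u~v)
    nbhd-injective {v} {w} (inj₂ u~v) (inj₂ u~w) eq with towards v u~v | towards w u~w
    ... | d , d≢e , v≡nb | d′ , d′≢e , w≡nb = value-injective (begin
      value v  ≡⟨ v≡nb ⟩
      nb d     ≡⟨ cong nb (slot-injective 2F e d d′ d≢e d′≢e (injective κ (begin
                    κ ⟨$⟩ʳ slot e d 3F   ≡⟨ vertex-neighbour v d d≢e v≡nb ⟨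
                    vertexColour v       ≡⟨ eq ⟩
                    vertexColour w       ≡⟨ vertex-neighbour w d′ d′≢e w≡nb ⟩
                    κ ⟨$⟩ʳ slot e d′ 3F  ∎))) ⟩
      nb d′    ≡⟨ w≡nb ⟨
      value w  ∎)
      where open ≡-Reasoning

    nbhd-surjective : ∀ c → ∃[ v ] ClosedNbr Λ u v × vertexColour v ≡ c
    nbhd-surjective c = find (κ ⟨$⟩ˡ c Fin.≟ 0F)
      where
      find : Dec (κ ⟨$⟩ˡ c ≡ 0F) → ∃[ v ] ClosedNbr Λ u v × vertexColour v ≡ c
      find (yes k≡0) = u , inj₁ refl , trans vertex-centre (trans (cong (κ ⟨$⟩ʳ_) (sym k≡0)) (inverseʳ κ))
      find (no k≢0) with slot-surjective 2F e (κ ⟨$⟩ˡ c) k≢0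
      ... | d , d≢e , slot≡k = neighbour d d≢e , inj₂ (u~neighbour d d≢e) ,
        trans (vertex-neighbour (neighbour d d≢e) d d≢e refl) (trans (cong (κ ⟨$⟩ʳ_) slot≡k) (inverseʳ κ))

  isETC : ∀ σ → IsETC (μ σ)
  isETC σ = record
    { total = record
      { vertex≢vertex = Around.vertex≢neighbour
      ; vertex≢edge   = λ u → Around.vertex≢edge u σ
      ; edge≢edge     = λ u → Around.edge≢edge u σ
      }
    ; efficient = λ v → efficient-injective v , λ c →
        let (u , u∈N , u≡c) = Around.nbhd-surjective v c in (u , [ u∈N ]) , λ { refl → u≡c }
    ; classes = λ c v →
        let (u , u∈N , u≡c) = Around.nbhd-surjective v c in
        u , (u∈N , u≡c) , λ (w∈N , w≡c) → Around.nbhd-injective v u∈N w∈N (trans u≡c (sym w≡c))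
    }
    where
    nbr? : ∀ v u → Dec (ClosedNbr Λ v u)
    nbr? v u = map′ value-injective (cong value) (value u ≟ᵥ value v) ⊎-dec (_ ℤ.≟ _)
    efficient-injective : ∀ v → Injective _≡_ _≡_ (λ (u : Refinement V (ClosedNbr Λ v)) → vertexColour (value u))
    efficient-injective v {x , [ x∈N ]} {y , [ y∈N ]} eq =
      value-injective (Around.nbhd-injective v (recompute (nbr? v x) x∈N) (recompute (nbr? v y) y∈N) eq)

  -- The words along the belts

  module _ (σ : Sense) {s C} (belt : IsBelt s C) where

    start : ∀ i → ∃[ j ] Cycle.at C i ≡ at s j
    start i with locate belt ε i
    ... | j , p , _ = j , p

    vertex-read : ∀ {i j} → Cycle.at C i ≡ at s j → ∀ n → vertexAt (μ σ) C (n ℕ.+ i) ≡ K s ⟪ n ℕ.+ j ⟫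
    vertex-read {j = j} p n = trans (cong vertexColour (synchronised belt ε p n)) (vertexColour-at s (n ℕ.+ j))

    edge-read : ∀ {i j} → Cycle.at C i ≡ at s j → ∀ n → edgeAt (μ σ) C (n ℕ.+ i) ≡ K s ⟪ lag σ ℕ.+ (n ℕ.+ j) ⟫
    edge-read {i} {j} p n =
      edgeColour-at σ s (n ℕ.+ j) (sym (synchronised belt ε p n)) (sym (synchronised belt ε p (ℕ.suc n)))
        (Cycle.step C (n ℕ.+ i))

  directed : ∀ s C → IsBelt s C → Directed (μ direct) C
  directed s C belt i edge≡0 with start direct belt i
  ... | j , p = begin
    vertexAt (μ direct) C i           ≡⟨ vertex-read direct belt p 0 ⟩
    K s ⟪ j ⟫                         ≡⟨ cong (K s ⟨$⟩ʳ_) (cyc⁴ (res j)) ⟨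
    K s ⟪ 4 ℕ.+ j ⟫                   ≡⟨ edge-read direct belt p 1 ⟨
    edgeAt (μ direct) C (1 ℕ.+ i)     ≡⟨ edge≡0 ⟩
    0F                                ∎
    where open ≡-Reasoning

  reversed : ∀ s C → IsBelt s C → Reversed (μ reverse) C
  reversed s C belt i edge≡0 with start reverse belt i
  ... | j , p = trans (vertex-read reverse belt p 2) (trans (sym (edge-read reverse belt p 0)) edge≡0)

  -- In both senses the copies of the word are delimited by the multiples of 4.
  module Word (σ : Sense) {s C} (belt : IsBelt s C) where

    j₀ : ℕ
    j₀ = proj₁ (start σ belt 0)

    r : Fin 4
    r = res j₀

    π₀ : Permutation′ 4
    π₀ = rot r ∘ₚ K s

    word-res : ∀ n m → res (n ℕ.+ (4 ℕ.* m ℕ.+ j₀)) ≡ r ⊕ res n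
    word-res n m = trans (res-+ n (4 ℕ.* m ℕ.+ j₀))
      (cong (_⊕ res n) (trans (cong (λ k → res (k ℕ.+ j₀)) (ℕ.*-comm 4 m)) (res-*4 m j₀)))

    sync : ∀ m → Cycle.at C (4 ℕ.* m ℕ.+ 0) ≡ at s (4 ℕ.* m ℕ.+ j₀)
    sync m = synchronised belt ε (proj₂ (start σ belt 0)) (4 ℕ.* m)

    vertex-word : ∀ n m → vertexAt (μ σ) C (n ℕ.+ (4 ℕ.* m ℕ.+ 0)) ≡ π₀ ⟨$⟩ʳ res n
    vertex-word n m = trans (vertex-read σ belt (sync m) n) (cong (K s ⟨$⟩ʳ_) (word-res n m))

    edge-word : ∀ n m → edgeAt (μ σ) C (n ℕ.+ (4 ℕ.* m ℕ.+ 0)) ≡ π₀ ⟨$⟩ʳ res (lag σ ℕ.+ n)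
    edge-word n m = trans (edge-read σ belt (sync m) n) (cong (K s ⟨$⟩ʳ_)
      (trans (cong res (sym (ℕ.+-assoc (lag σ) n _))) (word-res (lag σ ℕ.+ n) m)))

  -- With the vertex colours of a belt clockwise from position 0 numbered 0, 1, 2, 3,
  -- the letters a, b, c, d of the word are 0, 3, 1, 2 in the directed colouring,
  -- and 0, 1, 3, 2 in the reversed one, where the word runs counterclockwise.
  letters : Sense → Permutation′ 4
  letters direct = permutation f g (from-yes (all? λ x → f (g x) Fin.≟ x)) (from-yes (all? λ x → g (f x) Fin.≟ x))
    where
    f g : Fin 4 → Fin 4
    f 0F = 0F
    f 1F = 3F
    f 2F = 1F
    f 3F = 2F
    g 0F = 0F
    g 1F = 2F
    g 2F = 3F
    g 3F = 1F
  letters reverse = Perm.transpose 2F 3F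

  isPeriodic : ∀ σ → IsPeriodic (μ σ)
  isPeriodic direct s C belt = 4∣belts s C belt , letters direct ∘ₚ π₀ , 0 , inj₁ λ m → record
    { v₁ = vertex-word 0 m ; e₁ = edge-word 0 m ; v₂ = vertex-word 1 m ; e₂ = edge-word 1 m
    ; v₃ = vertex-word 2 m ; e₃ = edge-word 2 m ; v₄ = vertex-word 3 m ; e₄ = edge-word 3 m }
    where open Word direct belt
  isPeriodic reverse s C belt = 4∣belts s C belt , letters reverse ∘ₚ π₀ , 0 , inj₂ λ m → record
    { v₁ = vertex-word 4 m ; e₁ = edge-word 3 m ; v₂ = vertex-word 3 m ; e₂ = edge-word 2 m
    ; v₃ = vertex-word 2 m ; e₃ = edge-word 1 m ; v₄ = vertex-word 1 m ; e₄ = edge-word 0 m }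
    where open Word reverse belt

  -- The face colouring

  -- The residue of the positions of colour 0.
  zeroAt : Square → Fin 4
  zeroAt s = K s ⟨$⟩ˡ 0F

  -- The colours clockwise, starting from colour 0.
  fromZero : Square → Permutation′ 4
  fromZero s = rot (zeroAt s) ∘ₚ K s

  -- The colours 1, 2, 3 clockwise after colour 0.
  φ : Square → Permutation′ 3
  φ s = Perm.remove 0F (fromZero s)

  fromZero-0 : ∀ s → fromZero s ⟨$⟩ʳ 0F ≡ 0F
  fromZero-0 s = inverseʳ (K s)

  fromZero-suc : ∀ s j → fromZero s ⟨$⟩ʳ suc j ≡ suc (φ s ⟨$⟩ʳ j)
  fromZero-suc s j = sym (Perm.lift₀-remove (fromZero s) (fromZero-0 s) (suc j))

  φ-reads : ∀ σ s C → IsBelt s C → ∀ i → vertexAt (μ σ) C i ≡ 0F →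
            ∀ (j : Fin 3) → vertexAt (μ σ) C (ℕ.suc (toℕ j) ℕ.+ i) ≡ suc (φ s ⟨$⟩ʳ j)
  φ-reads σ s C belt i v≡0 j with start σ belt i
  ... | k , p = begin
    vertexAt (μ σ) C (toℕ (suc j) ℕ.+ i)     ≡⟨ vertex-read σ belt p (toℕ (suc j)) ⟩
    K s ⟪ toℕ (suc j) ℕ.+ k ⟫                ≡⟨ cong (K s ⟨$⟩ʳ_) (res-+ (toℕ (suc j)) k) ⟩
    K s ⟨$⟩ʳ (res k ⊕ res (toℕ (suc j)))     ≡⟨ cong₂ (λ a b → K s ⟨$⟩ʳ (a ⊕ b)) k≡zero (res-toℕ (suc j)) ⟩
    fromZero s ⟨$⟩ʳ suc j                    ≡⟨ fromZero-suc s j ⟩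
    suc (φ s ⟨$⟩ʳ j)                         ∎
    where
    open ≡-Reasoning
    k≡zero : res k ≡ zeroAt s
    k≡zero = trans (sym (inverseˡ (K s))) (cong (K s ⟨$⟩ˡ_) (trans (sym (vertex-read σ belt p 0)) v≡0))

  fromZero-cong : ∀ {s t} → φ s Perm.≈ φ t → fromZero s Perm.≈ fromZero t
  fromZero-cong {s} {t} φ≈ 0F = trans (fromZero-0 s) (sym (fromZero-0 t))
  fromZero-cong {s} {t} φ≈ (suc j) = trans (fromZero-suc s j) (trans (cong suc (φ≈ j)) (sym (fromZero-suc t j)))

  -- The permutation of a face determines which colour follows which.
  φ-next : ∀ {s t x y} → φ s Perm.≈ φ t → K s ⟨$⟩ʳ x ≡ K t ⟨$⟩ʳ y → K s ⟨$⟩ʳ cyc x ≡ K t ⟨$⟩ʳ cyc y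
  φ-next {s} {t} {x} {y} φ≈ x≡y = begin
    K s ⟨$⟩ʳ cyc x                          ≡⟨ advance s x ⟩
    fromZero s ⟨$⟩ʳ cyc (offset s x)        ≡⟨ fromZero-cong {s} {t} φ≈ (cyc (offset s x)) ⟩
    fromZero t ⟨$⟩ʳ cyc (offset s x)        ≡⟨ cong (λ k → fromZero t ⟨$⟩ʳ cyc k) sameOffset ⟩
    fromZero t ⟨$⟩ʳ cyc (offset t y)        ≡⟨ advance t y ⟨
    K t ⟨$⟩ʳ cyc y                          ∎
    where
    open ≡-Reasoning
    offset : Square → Fin 4 → Fin 4
    offset s x = neg (zeroAt s) ⊕ x
    recover : ∀ s x → K s ⟨$⟩ʳ x ≡ fromZero s ⟨$⟩ʳ offset s x
    recover s x = cong (K s ⟨$⟩ʳ_) (sym (⊕-neg-cancel (zeroAt s) x))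
    advance : ∀ s x → K s ⟨$⟩ʳ cyc x ≡ fromZero s ⟨$⟩ʳ cyc (offset s x)
    advance s x = cong (K s ⟨$⟩ʳ_)
      (sym (trans (⊕-cyc (zeroAt s) (offset s x)) (cong cyc (⊕-neg-cancel (zeroAt s) x))))
    sameOffset : offset s x ≡ offset t y
    sameOffset = injective (fromZero t) (begin
      fromZero t ⟨$⟩ʳ offset s x  ≡⟨ fromZero-cong {s} {t} φ≈ (offset s x) ⟨
      fromZero s ⟨$⟩ʳ offset s x  ≡⟨ recover s x ⟨
      K s ⟨$⟩ʳ x                  ≡⟨ x≡y ⟩
      K t ⟨$⟩ʳ y                  ≡⟨ recover t y ⟩
      fromZero t ⟨$⟩ʳ offset t y  ∎)

  belt-of-face : ∀ {s t C} → SameFace s t → IsBelt s C → IsBelt t C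
  belt-of-face s≈t belt = record
    { bounds = λ i → let (t′ , s≈t′ , side) = IsBelt.bounds belt i in t′ , sameFace-sym s≈t ◅◅ s≈t′ , side
    ; whole  = λ t′ u v t≈t′ → IsBelt.whole belt t′ u v (s≈t ◅◅ t≈t′)
    }

  -- One belt serves both squares, and both permutations are read off it.
  φ-constant : ∀ s t → SameFace s t → φ s Perm.≈ φ t
  φ-constant s t s≈t j = Fin.suc-injective (trans
    (sym (φ-reads direct s (B s) (B-belt s) i i≡0 j))
    (φ-reads direct t (B s) (belt-of-face s≈t (B-belt s)) i i≡0 j))
    where
    i : ℕ
    i = toℕ (zeroAt s)
    i≡0 : vertexColour (at s i) ≡ 0F
    i≡0 = trans (vertexColour-at s i) (trans (cong (K s ⟨$⟩ʳ_) (res-toℕ (zeroAt s))) (inverseʳ (K s)))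

  φ-proper : ∀ s t (u v : V) → Side s (value u) (value v) → Side t (value v) (value u) → ¬ (φ s Perm.≈ φ t)
  φ-proper s t u v right left φ≈
    with onBelt ε right (live u) (live v) | onBelt ε left (live v) (live u)
  ... | i , a , b | j , c , d with across (coherent right left) i j a b c d
  ...   | e₀ , e₁ , _ = cyc²≢ (res j) (injective (K t) (trans (sym (φ-next {s} {t} φ≈ e₀)) e₁))
    where
    cyc²≢ : ∀ a → cyc (cyc a) ≢ a
    cyc²≢ = from-yes (all? λ a → ¬? (cyc (cyc a) Fin.≟ a))

  yieldsPFC : ∀ σ → YieldsPFC (μ σ)
  yieldsPFC σ = isPeriodic σ , φ , record
    { constant = φ-constant
    ; reads    = φ-reads σ
    ; proper   = λ s t u v right left _ → φ-proper s t u v right left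
    }

theorem60 : (S : Pred ℤ² 0ℓ) (let open PlanarMap S) →
    IsPerfectDominating Γ S →
    IsMap →
    BeltLengthsDivisibleBy 4 →
    (∃[ μ ] IsDETGC μ × YieldsPFC μ) × (∃[ μ ] IsRETGC μ × YieldsPFC μ)
theorem60 S pds isMap 4∣belts =
  (μ direct , record { etgc = etc⇒etgc (isETC direct) ; directed = directed } , yieldsPFC direct) ,
  (μ reverse , record { etgc = etc⇒etgc (isETC reverse) ; reversed = reversed } , yieldsPFC reverse)
  where open Complement S pds isMap 4∣belts
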